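{- Let $M$ be a matroid. The reduced motivic zeta function of $M$ satisfies the functional equation \[ \overline{Z}_M(q^{ -1}, T^{ -1}) = q^{\operatorname{rk} M - 1}\, \overline{Z}_M(q,T). \]
   Context: Let $M$ be a matroid on a finite non-empty ground set $E$ with rank function $\operatorname{rk}$, characteristic polynomial $\chi_M(q)=\sum_{S\subseteq E}(-1)^{\#S}q^{\operatorname{rk}M-\operatorname{rk}S}$ and reduced characteristic polynomial $\overline{\chi}_M(q)=\chi_M(q)/(q-1)$. For $w\in\mathbb{R}^E$ set $\operatorname{wt}_M(w)=\max_{B\text{ basis}}\sum_{e\in B}w_e$ and let $M_w$ be the matroid on $E$ whose bases are the bases attaining this maximum. For $v\in\mathbb{R}^E/\mathbb{R}\mathbf{1}$ with lift $w$, set $\overline{\operatorname{wt}}_M(v)=\operatorname{wt}_M(w)-(\operatorname{rk}M)\min(w)$, $\overline{|v|}=\sum_e w_e-(\#E)\min(w)$, $M_v=M_w$. The reduced motivic zeta function is $\overline{Z}_M(q,T)=\sum_{v\in\mathbb{Z}^E/\mathbb{Z}\mathbf{1}}\overline{\chi}_{M_v}(q)q^{ -(\operatorname{rk}M-1)-\overline{\operatorname{wt}}_M(v)}T^{\overline{|v|}}$. It is a rational function of $q,T$, and the identity is understood in the field $\mathbb{Q}(q)(T)$. -}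

module Defs where

open import Data.Bool using (Bool; true; false; if_then_else_; _∧_)
open import Data.Nat as ℕ using (ℕ; zero; suc; _⊔_; _∸_)
open import Data.Integer as ℤ using (ℤ; +_; _+_; _*_; _-_; -_)
open import Data.List as List using (List; []; _∷_; _++_; map; filter; foldr; concatMap; upTo; length; zip)
open import Data.Vec as Vec using (Vec; []; _∷_; _[_]≔_; lookup)
open import Data.Fin using (Fin)
open import Data.Fin.Subset using (Subset; inside; outside; _∈_; _∉_; _∩_; ∣_∣; ⊤)
open import Data.Product using (Σ; _×_; _,_; ∃)
open import Relation.Binary.PropositionalEquality using (_≡_; _≢_)
open import Relation.Nullary.Decidable using (⌊_⌋; does)

allSubsets : (n : ℕ) → List (Subset n)
allSubsets zero    = [] ∷ []
allSubsets (suc n) = map (inside ∷_) (allSubsets n) ++ map (outside ∷_) (allSubsets n)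

maxL : List ℕ → ℕ
maxL = foldr _⊔_ 0

sumℤ : List ℤ → ℤ
sumℤ = foldr _+_ (+ 0)

sumℕ : {n : ℕ} → Vec ℕ n → ℕ
sumℕ = Vec.foldr _ ℕ._+_ 0

allVecs : (m n : ℕ) → List (Vec ℕ m)
allVecs zero    n = [] ∷ []
allVecs (suc m) n = concatMap (λ a → map (a ∷_) (allVecs m n)) (upTo (suc n))

BasisPred : ℕ → Set
BasisPred m = Subset m → Bool

record Matroid (m : ℕ) : Set where
  field
    isBasis  : BasisPred m
    nonempty : ∃ λ B → isBasis B ≡ true
    exchange : ∀ (B₁ B₂ : Subset m) (x : Fin m) →
               isBasis B₁ ≡ true → isBasis B₂ ≡ true → x ∈ B₁ → x ∉ B₂ →
               ∃ λ y → y ∈ B₂ × y ∉ B₁ ×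
                 isBasis ((B₁ [ x ]≔ outside) [ y ]≔ inside) ≡ true
open Matroid public

bases : {m : ℕ} → BasisPred m → List (Subset m)
bases {m} β = filter (λ B → β B Data.Bool.≟ true) (allSubsets m)
  where import Data.Bool

rankOf : {m : ℕ} → BasisPred m → Subset m → ℕ
rankOf β S = maxL (map (λ B → ∣ B ∩ S ∣) (bases β))

rkOf : {m : ℕ} → BasisPred m → ℕ
rkOf β = rankOf β ⊤

weight : {m : ℕ} → Vec ℕ m → Subset m → ℕ
weight []      []      = 0
weight (a ∷ w) (b ∷ B) = (if b then a else 0) ℕ.+ weight w B

wtOf : {m : ℕ} → BasisPred m → Vec ℕ m → ℕ
wtOf β w = maxL (map (weight w) (bases β))

-- bases of M_w: the bases of M attaining the maximum weight
-- (this set system is a matroid; we only need its basis predicate)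
restrictW : {m : ℕ} → BasisPred m → Vec ℕ m → BasisPred m
restrictW β w B = β B ∧ ⌊ weight w B ℕ.≟ wtOf β w ⌋

-- Characteristic polynomials (coefficient lists, index = degree)

sign : ℕ → ℤ
sign zero          = + 1
sign (suc zero)    = - (+ 1)
sign (suc (suc n)) = sign n

-- χ_M(q) = Σ_{S ⊆ E} (-1)^{#S} q^{rk M - rk S};  coefficients of q^0 .. q^{rk M}
charPoly : {m : ℕ} → BasisPred m → List ℤ
charPoly {m} β =
  map (λ k → sumℤ (map (λ S → if ⌊ (rkOf β ∸ rankOf β S) ℕ.≟ k ⌋ then sign ∣ S ∣ else + 0)
                        (allSubsets m)))
      (upTo (suc (rkOf β)))

-- quotient of a polynomial a₀ + a₁q + … + a_d q^d by (q - 1):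
-- b_i = a_{i+1} + … + a_d. (The division is exact iff Σ a_i = 0, which holds
-- for χ_M when E is non-empty.)
suffixSums : List ℤ → List ℤ
suffixSums []       = []
suffixSums (a ∷ as) = (a + sumℤ as) ∷ suffixSums as

divByQMinus1 : List ℤ → List ℤ
divByQMinus1 []       = []
divByQMinus1 (_ ∷ as) = suffixSums as

redCharPoly : {m : ℕ} → BasisPred m → List ℤ
redCharPoly β = divByQMinus1 (charPoly β)

-- Laurent polynomials in q, T with integer coefficients,
-- as finite lists of monomials (c , a , b) standing for c·q^a·T^b.

Poly2 : Set
Poly2 = List (ℤ × ℤ × ℤ)

coeff2 : Poly2 → ℤ → ℤ → ℤ
coeff2 P i j = sumℤ (map (λ { (c , a , b) →
  if ⌊ a ℤ.≟ i ⌋ ∧ ⌊ b ℤ.≟ j ⌋ then c else + 0 }) P)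

_·_ : Poly2 → Poly2 → Poly2
P · Q = concatMap (λ { (c , a , b) → map (λ { (d , a' , b') → (c * d , a + a' , b + b') }) Q }) P

invert : Poly2 → Poly2
invert = map (λ { (c , a , b) → (c , - a , - b) })

qPow : ℤ → Poly2
qPow k = (+ 1 , k , + 0) ∷ []

NonZero2 : Poly2 → Set
NonZero2 Q = ∃ λ i → ∃ λ j → coeff2 Q i j ≢ + 0

-- Every v ∈ ℤ^E/ℤ1 has a unique lift w with min w = 0; then w ∈ ℕ^E,
-- |v̄| = Σ w, wt̄_M(v) = wt_M(w), M_v = M_w.  The classes with |v̄| = n are
-- exactly the w ∈ ℕ^E with some entry 0 and Σ w = n (so all entries ≤ n).
reps : (m n : ℕ) → List (Vec ℕ m)
reps m n = filter (λ w → ⌊ sumℕ w ℕ.≟ n ⌋ Data.Bool.≟ true)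
                  (filter (λ w → Data.List.Relation.Unary.Any.any? (λ a → a ℕ.≟ 0) (Vec.toList w))
                          (allVecs m n))
  where import Data.Bool
        import Data.List.Relation.Unary.Any

indexed : {A : Set} → List A → List (ℕ × A)
indexed xs = zip (upTo (length xs)) xs

-- T^n-part of Z̄_M:
--   Σ_{|v̄| = n} χ̄_{M_v}(q) q^{-(rk M - 1) - wt̄_M(v)} T^n
zetaCoeff : {m : ℕ} → BasisPred m → ℕ → Poly2
zetaCoeff {m} β n =
  concatMap (λ w → map (λ { (i , c) →
      (c , ((+ i) - ((+ rkOf β) - + 1)) - (+ wtOf β w) , + n) })
    (indexed (redCharPoly (restrictW β w))))
  (reps m n)

zetaCoeff2 : {m : ℕ} → BasisPred m → ℤ → ℤ → ℤ
zetaCoeff2 β i (+ n)      = coeff2 (zetaCoeff β n) i (+ n)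
zetaCoeff2 β i ℤ.-[1+ n ] = + 0

mulZeta : {m : ℕ} → BasisPred m → Poly2 → ℤ → ℤ → ℤ
mulZeta β Q i j = sumℤ (map (λ { (c , a , b) → c * zetaCoeff2 β (i - a) (j - b) }) Q)

-- P / Q represents Z̄_M in ℚ(q)(T) ⊆ ℚ(q)((T)):  Q ≠ 0 and Q · Z̄_M = P
Represents : {m : ℕ} → BasisPred m → Poly2 → Poly2 → Set
Represents β P Q = NonZero2 Q × (∀ i j → mulZeta β Q i j ≡ coeff2 P i j)

module Submission where

-- Let r and rk_w be the rank functions of M and M_w, and put, for A ⊆ E,
--   Y_A = Σ_{w ∈ ℕ^A} Σ_{R ⊆ A} (-1)^{#R} q^{-rk_w R - wt w} T^{Σ w}.
-- A weight with support F is 1_F + w with w supported in F, and then the exchange property gives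
--   wt(1_F + w) = r F + wt w,   rk_{1_F + w} R = rk_w (R ∩ F) + r (R ∪ F) - r F.
-- Sorting the weights by their support and applying Möbius inversion yields, for every S,
--   Σ_{A ⊆ S} (-1)^{#A} Y_A = q^{-r S} Σ_{F ⊆ S} (-1)^{#F} T^{#F} Y_F.
-- Since 1 - q^{-r S} T^{#S} ≠ 0 for S ≠ ∅, this recurrence determines every Y_S from Y_∅ = 1.
-- The series T^{-#S} Y_S(q⁻¹ , T⁻¹) satisfy the same recurrence, so Y_S(q⁻¹ , T⁻¹) = T^{#S} Y_S(q , T).
-- The theorem follows from (1 - q⁻¹) Z̄_M = (1 - q^{-rk M} T^{#E}) Y_E.

open import Defs
import Algebra.Properties.CommutativeSemigroup
open import Data.Bool using (Bool; true; false; if_then_else_; _∧_)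
import Data.Bool.Properties as Boolₚ
open import Data.Empty using (⊥-elim)
open import Data.Fin as Fin using (Fin)
import Data.Fin.Properties as Finₚ
open import Data.Fin.Subset as Subset using (Subset; inside; outside; _∪_; _∩_; ∣_∣; ⊤; ⊥; ∁; _⊆_)
import Data.Fin.Subset.Properties as Subsetₚ
open import Data.Integer as ℤ using (ℤ; +_; -[1+_]; _+_; _*_; _-_; -_; _≟_)
import Data.Integer.Properties as ℤₚ
open import Data.Integer.Tactic.RingSolver using (solve-∀)
open import Data.List using (List; []; _∷_; _++_; map; concatMap; filter; upTo; applyUpTo; length; zip)
import Data.List.Properties as Listₚ
open import Data.List.Membership.Propositional using (_∈_)
import Data.List.Membership.Propositional.Properties as ∈ₚ
open import Data.List.Relation.Unary.Any as Anyₚ using (here; there)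
open import Data.Nat as ℕ using (ℕ; zero; suc)
import Data.Nat.Properties as ℕₚ
open import Data.Product using (∃; _×_; _,_; proj₁; proj₂)
open import Data.Sum using (_⊎_; inj₁; inj₂)
open import Data.Vec as Vec using (Vec; []; _∷_; _[_]≔_; lookup)
import Data.Vec.Properties as Vecₚ
open import Function using (_∘_; id)
open import Relation.Binary.PropositionalEquality
open import Relation.Nullary using (yes; no; does; ¬?)
open import Relation.Nullary.Decidable using (⌊_⌋; _×-dec_; decidable-stable; isYes≗does; dec-true)
open import Relation.Unary using (Decidable)

open ≡-Reasoning
open Algebra.Properties.CommutativeSemigroup ℕₚ.+-commutativeSemigroup using (x∙yz≈y∙xz)

-- Z̄_M is a series in T, but Z̄_M(q⁻¹ , T⁻¹) is a series in T⁻¹, and no ring of series holds both.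
-- They are compared inside the module of all coefficient functions on pairs of integers, on which
-- only Laurent polynomials act. This module has torsion: 1 - T annihilates the sum of T^n over all
-- integers n. So equality of series is replaced by equality to one fraction whose denominator is
-- not a zero divisor, and a denominator is cancelled only between Laurent polynomials, at the very
-- end. The summand of Y_E is (1 - q⁻¹) times a summand of Z̄_M, which removes the division in the
-- reduced polynomial. The condition of a zero entry has to go as well: once 1_F is subtracted from
-- a weight with support F, the rest is an arbitrary element of ℕ^F. Y_A itself is an infinite sum.
-- It is approximated by finite boxes of weights, and the coefficient of T^j is constant from some
-- box on.

private variable
  A B : Set
  m : ℕ

-- Finite sums of integers

∑ : {A : Set} → List A → (A → ℤ) → ℤ
∑ xs f = sumℤ (map f xs)

∑-cong : ∀ (xs : List A) {f g : A → ℤ} → (∀ {x} → x ∈ xs → f x ≡ g x) → ∑ xs f ≡ ∑ xs g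
∑-cong []       f≡g = refl
∑-cong (x ∷ xs) f≡g = cong₂ _+_ (f≡g (here refl)) (∑-cong xs (f≡g ∘ there))

∑-ext : ∀ (xs : List A) {f g : A → ℤ} → (∀ x → f x ≡ g x) → ∑ xs f ≡ ∑ xs g
∑-ext xs f≡g = ∑-cong xs (λ {x} _ → f≡g x)

∑-zero : ∀ (xs : List A) → ∑ xs (λ _ → + 0) ≡ + 0
∑-zero []       = refl
∑-zero (x ∷ xs) = trans (ℤₚ.+-identityˡ _) (∑-zero xs)

∑-+ : ∀ (xs : List A) (f g : A → ℤ) → ∑ xs (λ x → f x + g x) ≡ ∑ xs f + ∑ xs g
∑-+ []       f g = refl
∑-+ (x ∷ xs) f g = trans (cong (_+_ (f x + g x)) (∑-+ xs f g)) (exchange₄ (f x) (g x) (∑ xs f) (∑ xs g))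
  where
  exchange₄ : ∀ a b c d → (a + b) + (c + d) ≡ (a + c) + (b + d)
  exchange₄ = solve-∀

∑-*ˡ : ∀ (xs : List A) c (f : A → ℤ) → ∑ xs (λ x → c * f x) ≡ c * ∑ xs f
∑-*ˡ []       c f = sym (ℤₚ.*-zeroʳ c)
∑-*ˡ (x ∷ xs) c f = trans (cong (_+_ (c * f x)) (∑-*ˡ xs c f)) (sym (ℤₚ.*-distribˡ-+ c _ _))

∑-neg : ∀ (xs : List A) (f : A → ℤ) → ∑ xs (λ x → - f x) ≡ - ∑ xs f
∑-neg []       f = refl
∑-neg (x ∷ xs) f = trans (cong (_+_ (- f x)) (∑-neg xs f)) (sym (ℤₚ.neg-distrib-+ (f x) _))

∑-swap : ∀ (xs : List A) (ys : List B) (f : A → B → ℤ) →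
         ∑ xs (λ x → ∑ ys (f x)) ≡ ∑ ys (λ y → ∑ xs (λ x → f x y))
∑-swap []       ys f = sym (∑-zero ys)
∑-swap (x ∷ xs) ys f =
  trans (cong (_+_ (∑ ys (f x))) (∑-swap xs ys f)) (sym (∑-+ ys (f x) _))

∑-++ : ∀ (xs ys : List A) (f : A → ℤ) → ∑ (xs ++ ys) f ≡ ∑ xs f + ∑ ys f
∑-++ []       ys f = sym (ℤₚ.+-identityˡ _)
∑-++ (x ∷ xs) ys f = trans (cong (_+_ (f x)) (∑-++ xs ys f)) (sym (ℤₚ.+-assoc (f x) _ _))

∑-map : ∀ (g : A → B) xs (f : B → ℤ) → ∑ (map g xs) f ≡ ∑ xs (f ∘ g)
∑-map g xs f = cong sumℤ (sym (Listₚ.map-∘ xs))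

∑-concatMap : ∀ (g : A → List B) xs (f : B → ℤ) →
              ∑ (concatMap g xs) f ≡ ∑ xs (λ x → ∑ (g x) f)
∑-concatMap g []       f = refl
∑-concatMap g (x ∷ xs) f = trans (∑-++ (g x) _ f) (cong (_+_ (∑ (g x) f)) (∑-concatMap g xs f))

∑-filter : ∀ {P : A → Set} (P? : Decidable P) xs (f : A → ℤ) →
           ∑ (filter P? xs) f ≡ ∑ xs (λ x → if does (P? x) then f x else + 0)
∑-filter P? []       f = refl
∑-filter P? (x ∷ xs) f with does (P? x)
... | true  = cong (_+_ (f x)) (∑-filter P? xs f)
... | false = trans (∑-filter P? xs f) (sym (ℤₚ.+-identityˡ _))

-- Formal series unbounded in both directions, as a module over the Laurent polynomials

Series : Set
Series = ℤ → ℤ → ℤ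

infix 4 _≐_
_≐_ : Series → Series → Set
f ≐ g = ∀ i j → f i j ≡ g i j

≐-sym : ∀ {f g} → f ≐ g → g ≐ f
≐-sym p i j = sym (p i j)

≐-trans : ∀ {f g h} → f ≐ g → g ≐ h → f ≐ h
≐-trans p q i j = trans (p i j) (q i j)

coef : ℤ × ℤ × ℤ → ℤ
coef (c , _ , _) = c

degq : ℤ × ℤ × ℤ → ℤ
degq (_ , a , _) = a

degT : ℤ × ℤ × ℤ → ℤ
degT (_ , _ , b) = b

infixr 6 _▷_
_▷_ : Poly2 → Series → Series
(P ▷ f) i j = ∑ P (λ p → coef p * f (i - degq p) (j - degT p))

reflect : Series → Series
reflect f i j = f (- i) (- j)

δ₁ : ℤ → ℤ
δ₁ (+ zero) = + 1
δ₁ _        = + 0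

-- The constant series 1. `P ▷ δ` is the coefficient function of `P`, so products of Laurent
-- polynomials become iterated actions on `δ`.
δ : Series
δ i j = δ₁ i * δ₁ j

δ₁-neg : ∀ x → δ₁ (- x) ≡ δ₁ x
δ₁-neg (+ zero)  = refl
δ₁-neg (+ suc n) = refl
δ₁-neg -[1+ n ]  = refl

reflect-δ : reflect δ ≐ δ
reflect-δ i j = cong₂ _*_ (δ₁-neg i) (δ₁-neg j)

δ₁-off : ∀ {x} → x ≢ + 0 → δ₁ x ≡ + 0
δ₁-off {+ zero}    x≢0 = ⊥-elim (x≢0 refl)
δ₁-off {+ suc _}   _   = refl
δ₁-off { -[1+ _ ]} _   = refl

δ₁-≟ : ∀ a i → (if ⌊ a ≟ i ⌋ then + 1 else + 0) ≡ δ₁ (i - a)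
δ₁-≟ a i with a ≟ i
... | yes refl = sym (cong δ₁ (ℤₚ.i≡j⇒i-j≡0 {i} refl))
... | no  a≢i  = sym (δ₁-off (λ e → a≢i (sym (ℤₚ.i-j≡0⇒i≡j i a e))))

▷-cong : ∀ P {f g} → f ≐ g → P ▷ f ≐ P ▷ g
▷-cong P f≐g i j = ∑-ext P (λ p → cong (coef p *_) (f≐g _ _))

▷-++ : ∀ P Q f i j → ((P ++ Q) ▷ f) i j ≡ (P ▷ f) i j + (Q ▷ f) i j
▷-++ P Q f i j = ∑-++ P Q _

▷-+ : ∀ P f g → P ▷ (λ i j → f i j + g i j) ≐ (λ i j → (P ▷ f) i j + (P ▷ g) i j)
▷-+ P f g i j = trans (∑-ext P (λ p → ℤₚ.*-distribˡ-+ (coef p) _ _)) (∑-+ P _ _)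

▷-comm : ∀ P Q f → P ▷ Q ▷ f ≐ Q ▷ P ▷ f
▷-comm P Q f i j = begin
  ∑ P (λ p → coef p * ∑ Q (λ s → coef s * f (i - degq p - degq s) (j - degT p - degT s)))
    ≡⟨ ∑-ext P (λ p → sym (∑-*ˡ Q (coef p) _)) ⟩
  ∑ P (λ p → ∑ Q (λ s → coef p * (coef s * f (i - degq p - degq s) (j - degT p - degT s))))
    ≡⟨ ∑-swap P Q _ ⟩
  ∑ Q (λ s → ∑ P (λ p → coef p * (coef s * f (i - degq p - degq s) (j - degT p - degT s))))
    ≡⟨ ∑-ext Q (λ s → ∑-ext P (λ p → trans (*-swap (coef p) (coef s) _)
         (cong (λ t → coef s * (coef p * t)) (cong₂ f (-swap i _ _) (-swap j _ _))))) ⟩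
  ∑ Q (λ s → ∑ P (λ p → coef s * (coef p * f (i - degq s - degq p) (j - degT s - degT p))))
    ≡⟨ ∑-ext Q (λ s → ∑-*ˡ P (coef s) _) ⟩
  ∑ Q (λ s → coef s * ∑ P (λ p → coef p * f (i - degq s - degq p) (j - degT s - degT p))) ∎
  where
  *-swap : ∀ x y z → x * (y * z) ≡ y * (x * z)
  *-swap = solve-∀
  -swap : ∀ x y z → x - y - z ≡ x - z - y
  -swap = solve-∀

▷-· : ∀ P Q f → (P · Q) ▷ f ≐ P ▷ Q ▷ f
▷-· P Q f i j = trans (∑-concatMap _ P _) (∑-ext P (λ p → trans (trans (∑-map _ Q _)
    (∑-ext Q (λ s → trans (ℤₚ.*-assoc (coef p) _ _)
      (cong (λ t → coef p * (coef s * t)) (cong₂ f (-+ i _ _) (-+ j _ _))))))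
    (∑-*ˡ Q (coef p) _)))
  where
  -+ : ∀ x y z → x - (y + z) ≡ x - y - z
  -+ = solve-∀

▷-reflect : ∀ P f → invert P ▷ reflect f ≐ reflect (P ▷ f)
▷-reflect P f i j = trans (∑-map _ P _)
  (∑-ext P (λ p → cong (coef p *_) (cong₂ f (-neg i _) (-neg j _))))
  where
  -neg : ∀ x y → - (x - - y) ≡ - x - y
  -neg = solve-∀

coeff2-▷ : ∀ P → coeff2 P ≐ P ▷ δ
coeff2-▷ P i j = ∑-ext P monomial
  where
  monomial : ∀ p → (if ⌊ degq p ≟ i ⌋ ∧ ⌊ degT p ≟ j ⌋ then coef p else + 0)
                   ≡ coef p * δ (i - degq p) (j - degT p)
  monomial (c , a , b) rewrite sym (δ₁-≟ a i) | sym (δ₁-≟ b j) with ⌊ a ≟ i ⌋ | ⌊ b ≟ j ⌋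
  ... | true  | true  = sym (ℤₚ.*-identityʳ c)
  ... | true  | false = sym (ℤₚ.*-zeroʳ c)
  ... | false | _     = sym (ℤₚ.*-zeroʳ c)

coeff2-· : ∀ P Q → coeff2 (P · Q) ≐ P ▷ Q ▷ δ
coeff2-· P Q = ≐-trans (coeff2-▷ (P · Q)) (▷-· P Q δ)

-- The Laurent polynomial 1 - q^a T^b. Apart from `qPow (+ 0)`, all denominators below are products
-- of such factors.
binom : ℤ → ℤ → Poly2
binom a b = (+ 1 , + 0 , + 0) ∷ (- (+ 1) , a , b) ∷ []

binom-▷ : ∀ a b f i j → (binom a b ▷ f) i j ≡ f i j - f (i - a) (j - b)
binom-▷ a b f i j = trans (simplify (f (i - + 0) (j - + 0)) (f (i - a) (j - b)))
  (cong (_- f (i - a) (j - b)) (cong₂ f (ℤₚ.+-identityʳ i) (ℤₚ.+-identityʳ j)))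
  where
  simplify : ∀ x y → + 1 * x + (- (+ 1) * y + + 0) ≡ x - y
  simplify = solve-∀

qPow-▷ : ∀ k f i j → (qPow k ▷ f) i j ≡ f (i - k) j
qPow-▷ k f i j = trans (simplify (f (i - k) (j - + 0))) (cong (f (i - k)) (ℤₚ.+-identityʳ j))
  where
  simplify : ∀ x → + 1 * x + + 0 ≡ x
  simplify = solve-∀

-- Bounded supports and non-zero-divisors among the Laurent polynomials

coeff2-bounded : ∀ P → ∃ λ K → ∀ i j → K ℕ.< ℤ.∣ i ∣ ⊎ K ℕ.< ℤ.∣ j ∣ → coeff2 P i j ≡ + 0
coeff2-bounded P = proj₁ (bound P) , λ i j far → trans (coeff2-▷ P i j) (proj₂ (bound P) i j far)
  where
  bound : ∀ P → ∃ λ K → ∀ i j → K ℕ.< ℤ.∣ i ∣ ⊎ K ℕ.< ℤ.∣ j ∣ → (P ▷ δ) i j ≡ + 0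
  bound [] = 0 , λ _ _ _ → refl
  bound ((c , a , b) ∷ P) with bound P
  ... | K , vanish = K′ , vanish′
    where
    K′ = (ℤ.∣ a ∣ ℕ.+ ℤ.∣ b ∣) ℕ.+ K
    a≤K′ : ℤ.∣ a ∣ ℕ.≤ K′
    a≤K′ = ℕₚ.≤-trans (ℕₚ.m≤m+n _ _) (ℕₚ.m≤m+n _ K)
    b≤K′ : ℤ.∣ b ∣ ℕ.≤ K′
    b≤K′ = ℕₚ.≤-trans (ℕₚ.m≤n+m _ ℤ.∣ a ∣) (ℕₚ.m≤m+n _ K)
    apart : ∀ x y → ℤ.∣ y ∣ ℕ.≤ K′ → K′ ℕ.< ℤ.∣ x ∣ → δ₁ (x - y) ≡ + 0
    apart x y y≤K′ K′<x = δ₁-off λ e →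
      ℕₚ.<-irrefl (cong ℤ.∣_∣ (sym (ℤₚ.i-j≡0⇒i≡j x y e))) (ℕₚ.≤-<-trans y≤K′ K′<x)
    term≡0 : ∀ i j → K′ ℕ.< ℤ.∣ i ∣ ⊎ K′ ℕ.< ℤ.∣ j ∣ → δ (i - a) (j - b) ≡ + 0
    term≡0 i j (inj₁ i-far) = cong (_* δ₁ (j - b)) (apart i a a≤K′ i-far)
    term≡0 i j (inj₂ j-far) =
      trans (cong (δ₁ (i - a) *_) (apart j b b≤K′ j-far)) (ℤₚ.*-zeroʳ (δ₁ (i - a)))
    weaken : ∀ i j → K′ ℕ.< ℤ.∣ i ∣ ⊎ K′ ℕ.< ℤ.∣ j ∣ → K ℕ.< ℤ.∣ i ∣ ⊎ K ℕ.< ℤ.∣ j ∣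
    weaken _ _ (inj₁ p) = inj₁ (ℕₚ.≤-<-trans (ℕₚ.m≤n+m K _) p)
    weaken _ _ (inj₂ p) = inj₂ (ℕₚ.≤-<-trans (ℕₚ.m≤n+m K _) p)
    vanish′ : ∀ i j → K′ ℕ.< ℤ.∣ i ∣ ⊎ K′ ℕ.< ℤ.∣ j ∣ → (((c , a , b) ∷ P) ▷ δ) i j ≡ + 0
    vanish′ i j far = cong₂ _+_ (trans (cong (c *_) (term≡0 i j far)) (ℤₚ.*-zeroʳ c))
                                (vanish i j (weaken i j far))

-- Being a non-zero-divisor is asked for on Laurent polynomials only; on `Series` even 1 - T
-- annihilates something nonzero.
Regular : Poly2 → Set
Regular D = ∀ P → NonZero2 P → NonZero2 (D · P)

NonZero2-≐ : ∀ {P Q} → coeff2 P ≐ coeff2 Q → NonZero2 P → NonZero2 Q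
NonZero2-≐ P≐Q (i , j , P≢0) = i , j , λ Q≡0 → P≢0 (trans (P≐Q i j) Q≡0)

Regular-1 : Regular (qPow (+ 0))
Regular-1 P = NonZero2-≐ {P} {qPow (+ 0) · P} λ i j → sym (begin
  coeff2 (qPow (+ 0) · P) i j  ≡⟨ coeff2-· (qPow (+ 0)) P i j ⟩
  (qPow (+ 0) ▷ P ▷ δ) i j     ≡⟨ qPow-▷ (+ 0) (P ▷ δ) i j ⟩
  (P ▷ δ) (i - + 0) j          ≡⟨ cong (λ x → (P ▷ δ) x j) (ℤₚ.+-identityʳ i) ⟩
  (P ▷ δ) i j                  ≡⟨ coeff2-▷ P i j ⟨
  coeff2 P i j                 ∎)

Regular-· : ∀ {D D′} → Regular D → Regular D′ → Regular (D · D′)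
Regular-· {D} {D′} reg reg′ P P≢0 =
  NonZero2-≐ {D · (D′ · P)} {(D · D′) · P}
    (λ i j → begin
      coeff2 (D · (D′ · P)) i j  ≡⟨ coeff2-· D (D′ · P) i j ⟩
      (D ▷ (D′ · P) ▷ δ) i j     ≡⟨ ▷-cong D (▷-· D′ P δ) i j ⟩
      (D ▷ D′ ▷ P ▷ δ) i j       ≡⟨ ▷-· D D′ (P ▷ δ) i j ⟨
      ((D · D′) ▷ P ▷ δ) i j     ≡⟨ coeff2-· (D · D′) P i j ⟨
      coeff2 ((D · D′) · P) i j  ∎)
    (reg (D′ · P) (reg′ P P≢0))

jump : ∀ (g : ℕ → ℤ) N → g 0 ≢ + 0 → g N ≡ + 0 → ∃ λ n → g n ≢ g (suc n)
jump g zero    g0≢0 g0≡0 = ⊥-elim (g0≢0 g0≡0)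
jump g (suc N) g0≢0 gN≡0 with g 0 ≟ g 1
... | no  g0≢g1 = 0 , g0≢g1
... | yes g0≡g1 with jump (g ∘ suc) N (λ g1≡0 → g0≢0 (trans g0≡g1 g1≡0)) gN≡0
... | n , gn≢ = suc n , gn≢

-- The triangle inequality gives N ≤ |N a| ≤ |i - N a| + |i|.
line-escapes : ∀ K i a N → a ≢ + 0 → K ℕ.+ ℤ.∣ i ∣ ℕ.< N → K ℕ.< ℤ.∣ i - + N * a ∣
line-escapes K i a N a≢0 N-large = ℕₚ.+-cancelʳ-< ℤ.∣ i ∣ K _ (ℕₚ.<-≤-trans N-large N≤)
  where
  Na = + N * a
  instance
    a-nonZero : ℕ.NonZero ℤ.∣ a ∣
    a-nonZero = ℕ.≢-nonZero (a≢0 ∘ ℤₚ.∣i∣≡0⇒i≡0)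
  i-[i-x] : ∀ i x → i - (i - x) ≡ x
  i-[i-x] = solve-∀
  N≤ : N ℕ.≤ ℤ.∣ i - Na ∣ ℕ.+ ℤ.∣ i ∣
  N≤ = subst₂ ℕ._≤_ refl (ℕₚ.+-comm ℤ.∣ i ∣ _) (ℕₚ.≤-trans (ℕₚ.m≤m*n N ℤ.∣ a ∣)
    (subst (ℕ._≤ ℤ.∣ i ∣ ℕ.+ ℤ.∣ i - Na ∣) (trans (cong ℤ.∣_∣ (i-[i-x] i Na)) (ℤₚ.abs-* (+ N) a))
      (ℤₚ.∣i-j∣≤∣i∣+∣j∣ i (i - Na))))

-- Along the line through a nonzero coefficient in direction (a , b) the coefficients of P
-- eventually vanish, so two consecutive ones differ.
Regular-binom : ∀ a b → a ≢ + 0 ⊎ b ≢ + 0 → Regular (binom a b)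
Regular-binom a b ab≢0 P (i , j , P≢0) =
  let K , vanish = coeff2-bounded P
      -- `N` exceeds both K + |i| and K + |j|, so it serves whichever of `a` and `b` is nonzero.
      N = suc (K ℕ.+ (ℤ.∣ i ∣ ℕ.+ ℤ.∣ j ∣))
      g = λ n → coeff2 P (i - + n * a) (j - + n * b)
      n , gn≢ = jump g N
        (λ e → P≢0 (trans (cong₂ (coeff2 P) (sym (start i a)) (sym (start j b))) e))
        (vanish _ _ (escape K ab≢0))
  in i - + n * a , j - + n * b , λ e → gn≢ (ℤₚ.i-j≡0⇒i≡j _ _ (begin
    g n - g (suc n)
      ≡⟨ cong (_-_ (g n)) (cong₂ (coeff2 P) (next i (+ n) a) (next j (+ n) b)) ⟩
    g n - coeff2 P (i - + n * a - a) (j - + n * b - b)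
      ≡⟨ binom-▷ a b (coeff2 P) _ _ ⟨
    (binom a b ▷ coeff2 P) (i - + n * a) (j - + n * b)
      ≡⟨ ▷-cong (binom a b) (coeff2-▷ P) (i - + n * a) (j - + n * b) ⟩
    (binom a b ▷ P ▷ δ) (i - + n * a) (j - + n * b)
      ≡⟨ coeff2-· (binom a b) P (i - + n * a) (j - + n * b) ⟨
    coeff2 (binom a b · P) (i - + n * a) (j - + n * b)
      ≡⟨ e ⟩
    + 0 ∎))
  where
  start : ∀ x y → x - + 0 * y ≡ x
  start = solve-∀
  next : ∀ x n y → x - (+ 1 + n) * y ≡ x - n * y - y
  next = solve-∀
  escape : ∀ K → a ≢ + 0 ⊎ b ≢ + 0 → let N = suc (K ℕ.+ (ℤ.∣ i ∣ ℕ.+ ℤ.∣ j ∣)) in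
           K ℕ.< ℤ.∣ i - + N * a ∣ ⊎ K ℕ.< ℤ.∣ j - + N * b ∣
  escape K (inj₁ a≢0) = inj₁ (line-escapes K i a _ a≢0
    (ℕ.s≤s (ℕₚ.+-monoʳ-≤ K (ℕₚ.m≤m+n _ _))))
  escape K (inj₂ b≢0) = inj₂ (line-escapes K j b _ b≢0
    (ℕ.s≤s (ℕₚ.+-monoʳ-≤ K (ℕₚ.m≤n+m _ _))))

-- The difference `R` of `P` and `Q` is again a Laurent polynomial, so `Regular` applies to it: if
-- `R` had a nonzero coefficient, `D · R` would have one too.
▷-cancel : ∀ D P Q → Regular D → D ▷ coeff2 P ≐ D ▷ coeff2 Q → coeff2 P ≐ coeff2 Q
▷-cancel D P Q reg DP≐DQ i j with coeff2 P i j ≟ coeff2 Q i j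
... | yes P≡Q = P≡Q
... | no  P≢Q = ⊥-elim (DR≢0 (begin
    coeff2 (D · R) i′ j′           ≡⟨ coeff2-· D R i′ j′ ⟩
    (D ▷ R ▷ δ) i′ j′              ≡⟨ ▷-cong D (≐-sym (coeff2-▷ R)) i′ j′ ⟩
    (D ▷ coeff2 R) i′ j′           ≡⟨ ▷-cong D R≐P-Q i′ j′ ⟩
    (D ▷ (λ i j → coeff2 P i j + (neg ▷ coeff2 Q) i j)) i′ j′
                                   ≡⟨ ▷-+ D (coeff2 P) (neg ▷ coeff2 Q) i′ j′ ⟩
    (D ▷ coeff2 P) i′ j′ + (D ▷ neg ▷ coeff2 Q) i′ j′
      ≡⟨ cong₂ _+_ (DP≐DQ i′ j′) (trans (▷-comm D neg (coeff2 Q) i′ j′) (neg-▷ (D ▷ coeff2 Q) i′ j′)) ⟩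
    (D ▷ coeff2 Q) i′ j′ - (D ▷ coeff2 Q) i′ j′
                                   ≡⟨ ℤₚ.+-inverseʳ ((D ▷ coeff2 Q) i′ j′) ⟩
    + 0                            ∎))
  where
  neg : Poly2
  neg = (- (+ 1) , + 0 , + 0) ∷ []
  neg-▷ : ∀ f i j → (neg ▷ f) i j ≡ - f i j
  neg-▷ f i j = trans (simplify (f (i - + 0) (j - + 0)))
    (cong -_ (cong₂ f (ℤₚ.+-identityʳ i) (ℤₚ.+-identityʳ j)))
    where
    simplify : ∀ x → - (+ 1) * x + + 0 ≡ - x
    simplify = solve-∀
  R = P ++ (neg · Q)
  R≐P-Q : coeff2 R ≐ (λ i j → coeff2 P i j + (neg ▷ coeff2 Q) i j)
  R≐P-Q i j = begin
    coeff2 R i j                          ≡⟨ coeff2-▷ R i j ⟩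
    (R ▷ δ) i j                           ≡⟨ ▷-++ P (neg · Q) δ i j ⟩
    (P ▷ δ) i j + ((neg · Q) ▷ δ) i j
      ≡⟨ cong₂ _+_ (coeff2-▷ P i j) (trans (▷-cong neg (coeff2-▷ Q) i j) (sym (▷-· neg Q δ i j))) ⟨
    coeff2 P i j + (neg ▷ coeff2 Q) i j   ∎
  R≢0 : NonZero2 R
  R≢0 = i , j , λ e → P≢Q (ℤₚ.i-j≡0⇒i≡j _ _
    (trans (sym (trans (R≐P-Q i j) (cong (_+_ (coeff2 P i j)) (neg-▷ (coeff2 Q) i j)))) e))
  i′ = proj₁ (reg R R≢0)
  j′ = proj₁ (proj₂ (reg R R≢0))
  DR≢0 : coeff2 (D · R) i′ j′ ≢ + 0
  DR≢0 = proj₂ (proj₂ (reg R R≢0))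

-- Both series represent the same element of ℚ(q)(T), though they may be its expansions
-- at different points (T = 0 and T = ∞).
record SameRational (f g : Series) : Set where
  constructor sameRational
  field
    denominator numerator : Poly2
    regular               : Regular denominator
    equationˡ             : denominator ▷ f ≐ numerator ▷ δ
    equationʳ             : denominator ▷ g ≐ numerator ▷ δ

SameRational-≐ : ∀ {f f′ g g′} → f ≐ f′ → g ≐ g′ → SameRational f g → SameRational f′ g′
SameRational-≐ f≐f′ g≐g′ (sameRational D N reg Df Dg) = sameRational D N reg
  (λ i j → trans (sym (▷-cong D f≐f′ i j)) (Df i j))
  (λ i j → trans (sym (▷-cong D g≐g′ i j)) (Dg i j))

SameRational-refl : ∀ P → SameRational (P ▷ δ) (P ▷ δ)
SameRational-refl P = sameRational (qPow (+ 0)) P Regular-1 1▷ 1▷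
  where
  1▷ : qPow (+ 0) ▷ P ▷ δ ≐ P ▷ δ
  1▷ i j = trans (qPow-▷ (+ 0) (P ▷ δ) i j) (cong (λ x → (P ▷ δ) x j) (ℤₚ.+-identityʳ i))

SameRational-+ : ∀ {f f′ g g′} → SameRational f g → SameRational f′ g′ →
                 SameRational (λ i j → f i j + f′ i j) (λ i j → g i j + g′ i j)
SameRational-+ {f} {f′} {g} {g′} (sameRational D N reg Df Dg) (sameRational D′ N′ reg′ D′f D′g) =
  sameRational (D · D′) ((D′ · N) ++ (D · N′)) (Regular-· {D} {D′} reg reg′)
    (sum f f′ Df D′f) (sum g g′ Dg D′g)
  where
  sum : ∀ h h′ → D ▷ h ≐ N ▷ δ → D′ ▷ h′ ≐ N′ ▷ δ →
        (D · D′) ▷ (λ i j → h i j + h′ i j) ≐ ((D′ · N) ++ (D · N′)) ▷ δ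
  sum h h′ Dh D′h′ i j = begin
    ((D · D′) ▷ (λ i j → h i j + h′ i j)) i j
      ≡⟨ ▷-+ (D · D′) h h′ i j ⟩
    ((D · D′) ▷ h) i j + ((D · D′) ▷ h′) i j
      ≡⟨ cong₂ _+_ (trans (▷-· D D′ h i j) (▷-comm D D′ h i j)) (▷-· D D′ h′ i j) ⟩
    (D′ ▷ D ▷ h) i j + (D ▷ D′ ▷ h′) i j
      ≡⟨ cong₂ _+_ (▷-cong D′ Dh i j) (▷-cong D D′h′ i j) ⟩
    (D′ ▷ N ▷ δ) i j + (D ▷ N′ ▷ δ) i j
      ≡⟨ cong₂ _+_ (▷-· D′ N δ i j) (▷-· D N′ δ i j) ⟨
    ((D′ · N) ▷ δ) i j + ((D · N′) ▷ δ) i j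
      ≡⟨ ▷-++ (D′ · N) (D · N′) δ i j ⟨
    (((D′ · N) ++ (D · N′)) ▷ δ) i j ∎

SameRational-▷ : ∀ P {f g} → SameRational f g → SameRational (P ▷ f) (P ▷ g)
SameRational-▷ P {f} {g} (sameRational D N reg Df Dg) =
  sameRational D (P · N) reg (act f Df) (act g Dg)
  where
  act : ∀ h → D ▷ h ≐ N ▷ δ → D ▷ P ▷ h ≐ (P · N) ▷ δ
  act h Dh i j = trans (▷-comm D P h i j) (trans (▷-cong P Dh i j) (sym (▷-· P N δ i j)))

-- No series is divided: `P` merely joins the denominator, which stays a non-zero-divisor.
SameRational-÷ : ∀ P {f g} → Regular P → SameRational (P ▷ f) (P ▷ g) → SameRational f g
SameRational-÷ P {f} {g} reg (sameRational D N reg′ Df Dg) =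
  sameRational (D · P) N (Regular-· {D} {P} reg′ reg)
    (λ i j → trans (▷-· D P f i j) (Df i j)) (λ i j → trans (▷-· D P g i j) (Dg i j))

SameRational-∑ : ∀ (xs : List A) (f g : A → Series) →
                 (∀ {x} → x ∈ xs → SameRational (f x) (g x)) →
                 SameRational (λ i j → ∑ xs (λ x → f x i j)) (λ i j → ∑ xs (λ x → g x i j))
SameRational-∑ []       f g h = SameRational-refl []
SameRational-∑ (x ∷ xs) f g h =
  SameRational-+ (h (here refl)) (SameRational-∑ xs f g (h ∘ there))

-- Sums over subsets and over lattice points

below : Subset m → List (Subset m)
below []            = [] ∷ []
below (inside ∷ A)  = map (inside ∷_) (below A) ++ map (outside ∷_) (below A)
below (outside ∷ A) = map (outside ∷_) (below A)

-- The finite truncation of ℕ^A: entries below `N` on `A` and 0 elsewhere. As the bound is strict,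
-- adding 1_F leads from `box N` into `box (suc N)`.
box : ℕ → Subset m → List (Vec ℕ m)
box N []            = [] ∷ []
box N (inside ∷ A)  = concatMap (λ a → map (a ∷_) (box N A)) (upTo N)
box N (outside ∷ A) = map (0 ∷_) (box N A)

-- The weight 1_F + w.
bump : Subset m → Vec ℕ m → Vec ℕ m
bump []            []      = []
bump (inside ∷ F)  (a ∷ w) = suc a ∷ bump F w
bump (outside ∷ F) (a ∷ w) = a ∷ bump F w

allSubsets≡below : ∀ m → allSubsets m ≡ below ⊤
allSubsets≡below zero    = refl
allSubsets≡below (suc m) =
  cong (λ ys → map (inside ∷_) ys ++ map (outside ∷_) ys) (allSubsets≡below m)

allVecs≡box : ∀ m n → allVecs m n ≡ box (suc n) ⊤
allVecs≡box zero    n = refl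
allVecs≡box (suc m) n =
  cong (λ ws → concatMap (λ a → map (a ∷_) ws) (upTo (suc n))) (allVecs≡box m n)

∑-below-inside : ∀ (A : Subset m) f →
  ∑ (below (inside ∷ A)) f ≡ ∑ (below A) (f ∘ (inside ∷_)) + ∑ (below A) (f ∘ (outside ∷_))
∑-below-inside A f = trans (∑-++ (map (inside ∷_) (below A)) _ f)
  (cong₂ _+_ (∑-map _ (below A) f) (∑-map _ (below A) f))

∑-below-outside : ∀ (A : Subset m) f →
  ∑ (below (outside ∷ A)) f ≡ ∑ (below A) (f ∘ (outside ∷_))
∑-below-outside A f = ∑-map _ (below A) f

∑-box-inside : ∀ N (A : Subset m) f →
  ∑ (box N (inside ∷ A)) f ≡ ∑ (upTo N) (λ a → ∑ (box N A) (f ∘ (a ∷_)))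
∑-box-inside N A f = trans (∑-concatMap _ (upTo N) f)
  (∑-ext (upTo N) (λ a → ∑-map (a ∷_) (box N A) f))

∑-upTo-suc : ∀ N f → ∑ (upTo (suc N)) f ≡ f 0 + ∑ (upTo N) (f ∘ suc)
∑-upTo-suc N f = cong (_+_ (f 0)) (trans
  (cong (λ xs → ∑ xs f) (sym (Listₚ.map-applyUpTo id suc N))) (∑-map suc (upTo N) f))

-- A weight is `bump F w` for exactly one `F`, its support, and one `w` supported in `F`.
-- Subtracting 1_F lowers the bound on the entries by one.
∑-box-suc : ∀ N (A : Subset m) f →
  ∑ (box (suc N) A) f ≡ ∑ (below A) (λ F → ∑ (box N F) (f ∘ bump F))
∑-box-suc N []            f = sym (ℤₚ.+-identityʳ _)
∑-box-suc N (outside ∷ A) f = begin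
  ∑ (box (suc N) (outside ∷ A)) f
    ≡⟨ ∑-map _ (box (suc N) A) f ⟩
  ∑ (box (suc N) A) (f ∘ (0 ∷_))
    ≡⟨ ∑-box-suc N A _ ⟩
  ∑ (below A) (λ F → ∑ (box N F) (λ w → f (0 ∷ bump F w)))
    ≡⟨ ∑-ext (below A) (λ F → ∑-map (0 ∷_) (box N F) (f ∘ bump (outside ∷ F))) ⟨
  ∑ (below A) (λ F → ∑ (box N (outside ∷ F)) (f ∘ bump (outside ∷ F)))
    ≡⟨ ∑-below-outside A _ ⟨
  ∑ (below (outside ∷ A)) (λ F → ∑ (box N F) (f ∘ bump F)) ∎
∑-box-suc N (inside ∷ A) f = begin
  ∑ (box (suc N) (inside ∷ A)) f
    ≡⟨ ∑-box-inside (suc N) A f ⟩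
  ∑ (upTo (suc N)) (λ a → ∑ (box (suc N) A) (f ∘ (a ∷_)))
    ≡⟨ ∑-ext (upTo (suc N)) (λ a → ∑-box-suc N A _) ⟩
  ∑ (upTo (suc N)) (λ a → ∑ (below A) (λ F → ∑ (box N F) (λ w → f (a ∷ bump F w))))
    ≡⟨ ∑-upTo-suc N (λ a → ∑ (below A) (λ F → ∑ (box N F) (λ w → f (a ∷ bump F w)))) ⟩
  ∑ (below A) (λ F → ∑ (box N F) (λ w → f (0 ∷ bump F w))) +
  ∑ (upTo N) (λ a → ∑ (below A) (λ F → ∑ (box N F) (λ w → f (suc a ∷ bump F w))))
    ≡⟨ cong₂ _+_
         (∑-ext (below A) (λ F → sym (∑-map (0 ∷_) (box N F) (f ∘ bump (outside ∷ F)))))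
         (trans (∑-swap (upTo N) (below A) _)
           (∑-ext (below A) (λ F → sym (∑-box-inside N F (f ∘ bump (inside ∷ F)))))) ⟩
  ∑ (below A) (λ F → ∑ (box N (outside ∷ F)) (f ∘ bump (outside ∷ F))) +
  ∑ (below A) (λ F → ∑ (box N (inside ∷ F)) (f ∘ bump (inside ∷ F)))
    ≡⟨ ℤₚ.+-comm (∑ (below A) (λ F → ∑ (box N (outside ∷ F)) (f ∘ bump (outside ∷ F)))) _ ⟩
  ∑ (below A) (λ F → ∑ (box N (inside ∷ F)) (f ∘ bump (inside ∷ F))) +
  ∑ (below A) (λ F → ∑ (box N (outside ∷ F)) (f ∘ bump (outside ∷ F)))
    ≡⟨ ∑-below-inside A (λ F → ∑ (box N F) (f ∘ bump F)) ⟨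
  ∑ (below (inside ∷ A)) (λ F → ∑ (box N F) (f ∘ bump F)) ∎

-- (F , R) ↦ (F , R ∩ F , R ∪ F) is a bijection from pairs of subsets of A onto
-- the triples R₁ ⊆ F ⊆ S ⊆ A.
∑-below² : ∀ (A : Subset m) (f : Subset m → Subset m → Subset m → ℤ) →
  ∑ (below A) (λ F → ∑ (below A) (λ R → f F (R ∩ F) (R ∪ F))) ≡
  ∑ (below A) (λ S → ∑ (below S) (λ F → ∑ (below F) (λ R → f F R S)))
∑-below² []            f = sym (ℤₚ.+-identityʳ _)
∑-below² (outside ∷ A) f = begin
  ∑ (below (outside ∷ A)) (λ F → ∑ (below (outside ∷ A)) (λ R → f F (R ∩ F) (R ∪ F)))
    ≡⟨ ∑-below-outside A _ ⟩
  ∑ (below A) (λ F → ∑ (below (outside ∷ A)) (λ R → f (outside ∷ F) (R ∩ (outside ∷ F)) (R ∪ (outside ∷ F))))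
    ≡⟨ ∑-ext (below A) (λ F → ∑-below-outside A _) ⟩
  ∑ (below A) (λ F → ∑ (below A) (λ R → f (outside ∷ F) (outside ∷ (R ∩ F)) (outside ∷ (R ∪ F))))
    ≡⟨ ∑-below² A (λ F R S → f (outside ∷ F) (outside ∷ R) (outside ∷ S)) ⟩
  ∑ (below A) (λ S → ∑ (below S) (λ F → ∑ (below F) (λ R → f (outside ∷ F) (outside ∷ R) (outside ∷ S))))
    ≡⟨ ∑-ext (below A) (λ S → ∑-ext (below S) (λ F → ∑-below-outside F _)) ⟨
  ∑ (below A) (λ S → ∑ (below S) (λ F → ∑ (below (outside ∷ F)) (λ R → f (outside ∷ F) R (outside ∷ S))))
    ≡⟨ ∑-ext (below A) (λ S → ∑-below-outside S _) ⟨
  ∑ (below A) (λ S → ∑ (below (outside ∷ S)) (λ F → ∑ (below F) (λ R → f F R (outside ∷ S))))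
    ≡⟨ ∑-below-outside A _ ⟨
  ∑ (below (outside ∷ A)) (λ S → ∑ (below S) (λ F → ∑ (below F) (λ R → f F R S))) ∎
∑-below² (inside ∷ A) f = begin
  ∑ (below (inside ∷ A)) (λ F → ∑ (below (inside ∷ A)) (λ R → f F (R ∩ F) (R ∪ F)))
    ≡⟨ ∑-below-inside A _ ⟩
  ∑ (below A) (λ F → ∑ (below (inside ∷ A)) (λ R → f (inside ∷ F) (R ∩ (inside ∷ F)) (R ∪ (inside ∷ F)))) +
  ∑ (below A) (λ F → ∑ (below (inside ∷ A)) (λ R → f (outside ∷ F) (R ∩ (outside ∷ F)) (R ∪ (outside ∷ F))))
    ≡⟨ cong₂ _+_ (split _) (split _) ⟩
  (pairs iii + pairs ioi) + (pairs ooi + pairs ooo)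
    ≡⟨ cong₂ _+_ (cong₂ _+_ (∑-below² A iii) (∑-below² A ioi)) (cong₂ _+_ (∑-below² A ooi) (∑-below² A ooo)) ⟩
  (triples iii + triples ioi) + (triples ooi + triples ooo)
    ≡⟨ ℤₚ.+-assoc (triples iii + triples ioi) (triples ooi) (triples ooo) ⟨
  ((triples iii + triples ioi) + triples ooi) + triples ooo
    ≡⟨ cong₂ _+_ (trans (∑-+ (below A) _ _) (cong (_+ triples ooi) (∑-+ (below A) _ _))) refl ⟨
  ∑ (below A) (λ S → (∑ (below S) (λ F → ∑ (below F) (λ R → iii F R S)) +
                      ∑ (below S) (λ F → ∑ (below F) (λ R → ioi F R S))) +
                      ∑ (below S) (λ F → ∑ (below F) (λ R → ooi F R S))) + triples ooo
    ≡⟨ cong₂ _+_ (∑-ext (below A) (λ S → trans (∑-below-inside S _) (cong₂ _+_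
           (trans (∑-ext (below S) (λ F → ∑-below-inside F _)) (∑-+ (below S) _ _))
           (∑-ext (below S) (λ F → ∑-below-outside F _)))))
         (∑-ext (below A) (λ S → trans (∑-below-outside S _)
           (∑-ext (below S) (λ F → ∑-below-outside F _)))) ⟨
  ∑ (below A) (λ S → ∑ (below (inside ∷ S)) (λ F → ∑ (below F) (λ R → f F R (inside ∷ S)))) +
  ∑ (below A) (λ S → ∑ (below (outside ∷ S)) (λ F → ∑ (below F) (λ R → f F R (outside ∷ S))))
    ≡⟨ ∑-below-inside A _ ⟨
  ∑ (below (inside ∷ A)) (λ S → ∑ (below S) (λ F → ∑ (below F) (λ R → f F R S))) ∎
  where
  Ternary = Subset _ → Subset _ → Subset _ → ℤ
  -- The letters tell whether the new element lies in `F`, `R` and `S`, in this order. Only these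
  -- four patterns respect R ⊆ F ⊆ S.
  iii ioi ooi ooo : Ternary
  iii F R S = f (inside ∷ F) (inside ∷ R) (inside ∷ S)
  ioi F R S = f (inside ∷ F) (outside ∷ R) (inside ∷ S)
  ooi F R S = f (outside ∷ F) (outside ∷ R) (inside ∷ S)
  ooo F R S = f (outside ∷ F) (outside ∷ R) (outside ∷ S)
  pairs triples : Ternary → ℤ
  pairs g   = ∑ (below A) (λ F → ∑ (below A) (λ R → g F (R ∩ F) (R ∪ F)))
  triples g = ∑ (below A) (λ S → ∑ (below S) (λ F → ∑ (below F) (λ R → g F R S)))
  split : ∀ (g : Subset _ → Subset _ → ℤ) →
    ∑ (below A) (λ F → ∑ (below (inside ∷ A)) (g F)) ≡
    ∑ (below A) (λ F → ∑ (below A) (g F ∘ (inside ∷_))) +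
    ∑ (below A) (λ F → ∑ (below A) (g F ∘ (outside ∷_)))
  split g = trans (∑-ext (below A) (λ F → ∑-below-inside A (g F))) (∑-+ (below A) _ _)

-- Signs and Möbius inversion on subsets

sgn : Subset m → ℤ
sgn S = sign ∣ S ∣

sign-suc : ∀ n → sign (suc n) ≡ - sign n
sign-suc zero          = refl
sign-suc (suc zero)    = refl
sign-suc (suc (suc n)) = sign-suc n

sign² : ∀ n → sign n * sign n ≡ + 1
sign² zero          = refl
sign² (suc zero)    = refl
sign² (suc (suc n)) = sign² n

sgn-inside-* : ∀ (S : Subset m) x → sgn (inside ∷ S) * x ≡ - (sgn S * x)
sgn-inside-* S x = trans (cong (_* x) (sign-suc ∣ S ∣)) (sym (ℤₚ.neg-distribˡ-* (sgn S) x))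

-- This is #R + #F = #(R ∩ F) + #(R ∪ F) modulo 2, a sign being its own inverse.
sgn-∩-∪ : ∀ (F R : Subset m) → sgn R ≡ sgn (R ∪ F) * (sgn F * sgn (R ∩ F))
sgn-∩-∪ []            []            = refl
sgn-∩-∪ (outside ∷ F) (outside ∷ R) = sgn-∩-∪ F R
sgn-∩-∪ (outside ∷ F) (inside ∷ R)  = trans (sign-suc ∣ R ∣) (trans (cong -_ (sgn-∩-∪ F R))
  (sym (sgn-inside-* (R ∪ F) _)))
sgn-∩-∪ (inside ∷ F)  (outside ∷ R) = trans (sgn-∩-∪ F R) (sym (
  trans (cong₂ _*_ (sign-suc ∣ R ∪ F ∣) (cong (_* sgn (R ∩ F)) (sign-suc ∣ F ∣)))
        (neg-neg (sgn (R ∪ F)) (sgn F) (sgn (R ∩ F)))))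
  where
  neg-neg : ∀ x y z → - x * (- y * z) ≡ x * (y * z)
  neg-neg = solve-∀
sgn-∩-∪ (inside ∷ F)  (inside ∷ R)  = trans (sign-suc ∣ R ∣) (trans (cong -_ (sgn-∩-∪ F R)) (sym (
  trans (cong₂ _*_ (sign-suc ∣ R ∪ F ∣) (cong₂ _*_ (sign-suc ∣ F ∣) (sign-suc ∣ R ∩ F ∣)))
        (neg-neg-neg (sgn (R ∪ F)) (sgn F) (sgn (R ∩ F))))))
  where
  neg-neg-neg : ∀ x y z → - x * (- y * - z) ≡ - (x * (y * z))
  neg-neg-neg = solve-∀

-- On the left `h F` occurs with coefficient Σ (-1)^{#A} over F ⊆ A ⊆ S, and this vanishes unless F
-- = S. In the induction the sets that avoid the new element cancel against half of the contribution
-- of those that contain it.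
möbius : ∀ (S : Subset m) h → ∑ (below S) (λ A → sgn A * ∑ (below A) h) ≡ sgn S * h S
möbius []            h = trivial (h [])
  where
  trivial : ∀ x → + 1 * (x + + 0) + + 0 ≡ + 1 * x
  trivial = solve-∀
möbius (outside ∷ S) h = trans (∑-below-outside S _) (trans
  (∑-ext (below S) (λ A → cong (_*_ (sgn A)) (∑-below-outside A h)))
  (möbius S (h ∘ (outside ∷_))))
möbius (inside ∷ S)  h = begin
  ∑ (below (inside ∷ S)) (λ A → sgn A * ∑ (below A) h)
    ≡⟨ ∑-below-inside S _ ⟩
  ∑ (below S) (λ A → sgn (inside ∷ A) * ∑ (below (inside ∷ A)) h) +
  ∑ (below S) (λ A → sgn A * ∑ (below (outside ∷ A)) h)
    ≡⟨ ∑-+ (below S) _ _ ⟨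
  ∑ (below S) (λ A → sgn (inside ∷ A) * ∑ (below (inside ∷ A)) h + sgn A * ∑ (below (outside ∷ A)) h)
    ≡⟨ ∑-ext (below S) (λ A → trans
         (cong₂ (λ x y → sgn (inside ∷ A) * x + sgn A * y) (∑-below-inside A h) (∑-below-outside A h))
         (trans (cong (_+ sgn A * out A) (sgn-inside-* A (inn A + out A))) (telescope (sgn A) (inn A) (out A)))) ⟩
  ∑ (below S) (λ A → - (sgn A * inn A))
    ≡⟨ ∑-neg (below S) _ ⟩
  - ∑ (below S) (λ A → sgn A * inn A)
    ≡⟨ cong -_ (möbius S (h ∘ (inside ∷_))) ⟩
  - (sgn S * h (inside ∷ S))
    ≡⟨ sgn-inside-* S _ ⟨
  sgn (inside ∷ S) * h (inside ∷ S) ∎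
  where
  inn out : Subset _ → ℤ
  inn A = ∑ (below A) (h ∘ (inside ∷_))
  out A = ∑ (below A) (h ∘ (outside ∷_))
  telescope : ∀ s x y → - (s * (x + y)) + s * y ≡ - (s * x)
  telescope = solve-∀

∑-sgn-⊤ : ∀ m → ∑ (below (⊤ {suc m})) sgn ≡ + 0
∑-sgn-⊤ m = trans (∑-below-inside E sgn) (trans
  (cong (_+ ∑ (below E) sgn) (trans (∑-ext (below E) (λ S → sign-suc ∣ S ∣)) (∑-neg (below E) sgn)))
  (ℤₚ.+-inverseˡ (∑ (below E) sgn)))
  where
  E : Subset m
  E = ⊤

below-∣∣ : ∀ (S : Subset m) {F} → F ∈ below S → ∣ F ∣ ℕ.≤ ∣ S ∣
below-∣∣ []            (here refl) = ℕ.z≤n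
below-∣∣ (outside ∷ S) F∈ with ∈ₚ.∈-map⁻ (outside ∷_) F∈
... | _ , F′∈ , refl = below-∣∣ S F′∈
below-∣∣ (inside ∷ S)  F∈ with ∈ₚ.∈-++⁻ (map (inside ∷_) (below S)) F∈
... | inj₁ F∈in with ∈ₚ.∈-map⁻ (inside ∷_) F∈in
...   | _ , F′∈ , refl = ℕ.s≤s (below-∣∣ S F′∈)
below-∣∣ (inside ∷ S)  F∈ | inj₂ F∈out with ∈ₚ.∈-map⁻ (outside ∷_) F∈out
...   | _ , F′∈ , refl = ℕₚ.m≤n⇒m≤1+n (below-∣∣ S F′∈)

properBelow : Subset m → List (Subset m)
properBelow []            = []
properBelow (inside ∷ S)  = map (inside ∷_) (properBelow S) ++ map (outside ∷_) (below S)
properBelow (outside ∷ S) = map (outside ∷_) (properBelow S)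

below≡self∷proper : ∀ (S : Subset m) → below S ≡ S ∷ properBelow S
below≡self∷proper []            = refl
below≡self∷proper (inside ∷ S)  =
  cong (λ xs → map (inside ∷_) xs ++ map (outside ∷_) (below S)) (below≡self∷proper S)
below≡self∷proper (outside ∷ S) = cong (map (outside ∷_)) (below≡self∷proper S)

properBelow-∣∣ : ∀ (S : Subset m) {F} → F ∈ properBelow S → ∣ F ∣ ℕ.< ∣ S ∣
properBelow-∣∣ (outside ∷ S) F∈ with ∈ₚ.∈-map⁻ (outside ∷_) F∈
... | _ , F′∈ , refl = properBelow-∣∣ S F′∈
properBelow-∣∣ (inside ∷ S)  F∈ with ∈ₚ.∈-++⁻ (map (inside ∷_) (properBelow S)) F∈
... | inj₁ F∈in with ∈ₚ.∈-map⁻ (inside ∷_) F∈in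
...   | _ , F′∈ , refl = ℕ.s≤s (properBelow-∣∣ S F′∈)
properBelow-∣∣ (inside ∷ S)  F∈ | inj₂ F∈out with ∈ₚ.∈-map⁻ (outside ∷_) F∈out
...   | _ , F′∈ , refl = ℕ.s≤s (below-∣∣ S F′∈)

-- Weights and ranks of a matroid

maxL-upper : ∀ {x} xs → x ∈ xs → x ℕ.≤ maxL xs
maxL-upper (x ∷ xs) (here refl) = ℕₚ.m≤m⊔n x (maxL xs)
maxL-upper (y ∷ xs) (there x∈)  = ℕₚ.≤-trans (maxL-upper xs x∈) (ℕₚ.m≤n⊔m y (maxL xs))

maxL-∷ : ∀ x xs → maxL (x ∷ xs) ∈ x ∷ xs
maxL-∷ x []       = here (ℕₚ.⊔-identityʳ x)
maxL-∷ x (y ∷ xs) with ℕₚ.⊔-sel x (maxL (y ∷ xs))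
... | inj₁ e = here e
... | inj₂ e = there (subst (_∈ y ∷ xs) (sym e) (maxL-∷ y xs))

maxL-attained : ∀ {x} xs → x ∈ xs → maxL xs ∈ xs
maxL-attained (x ∷ xs) _ = maxL-∷ x xs

∈-allSubsets : ∀ (S : Subset m) → S ∈ allSubsets m
∈-allSubsets []            = here refl
∈-allSubsets (inside ∷ S)  = ∈ₚ.∈-++⁺ˡ (∈ₚ.∈-map⁺ (inside ∷_) (∈-allSubsets S))
∈-allSubsets (outside ∷ S) = ∈ₚ.∈-++⁺ʳ (map (inside ∷_) (allSubsets _)) (∈ₚ.∈-map⁺ (outside ∷_) (∈-allSubsets S))

module _ (β : BasisPred m) (f : Subset m → ℕ) where

  ∈-bases : ∀ {B} → β B ≡ true → B ∈ bases β
  ∈-bases = ∈ₚ.∈-filter⁺ (λ B → β B Boolₚ.≟ true) (∈-allSubsets _)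

  max-upper : ∀ {B} → β B ≡ true → f B ℕ.≤ maxL (map f (bases β))
  max-upper Bβ = maxL-upper _ (∈ₚ.∈-map⁺ f (∈-bases Bβ))

  max-attained : ∃ (λ B → β B ≡ true) → ∃ λ B → β B ≡ true × f B ≡ maxL (map f (bases β))
  max-attained (B , Bβ) with ∈ₚ.∈-map⁻ f (maxL-attained _ (∈ₚ.∈-map⁺ f (∈-bases Bβ)))
  ... | C , C∈ , e = C , proj₂ (∈ₚ.∈-filter⁻ (λ B → β B Boolₚ.≟ true) {xs = allSubsets m} C∈) , sym e

module _ (β : BasisPred m) (w : Vec ℕ m) {B : Subset m} where

  restrictW⁻ : restrictW β w B ≡ true → β B ≡ true × weight w B ≡ wtOf β w
  restrictW⁻ e with β B | weight w B ℕₚ.≟ wtOf β w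
  restrictW⁻ e  | true  | yes p = refl , p
  restrictW⁻ () | true  | no _
  restrictW⁻ () | false | _

  restrictW⁺ : β B ≡ true → weight w B ≡ wtOf β w → restrictW β w B ≡ true
  restrictW⁺ Bβ e rewrite Bβ =
    trans (isYes≗does (weight w B ℕₚ.≟ wtOf β w)) (dec-true (weight w B ℕₚ.≟ wtOf β w) e)

∣∣-∩-∁ : ∀ (B F : Subset m) → ∣ B ∩ F ∣ ℕ.+ ∣ B ∩ ∁ F ∣ ≡ ∣ B ∣
∣∣-∩-∁ []            []            = refl
∣∣-∩-∁ (outside ∷ B) (_ ∷ F)       = ∣∣-∩-∁ B F
∣∣-∩-∁ (inside ∷ B)  (inside ∷ F)  = cong suc (∣∣-∩-∁ B F)
∣∣-∩-∁ (inside ∷ B)  (outside ∷ F) = trans (ℕₚ.+-suc _ _) (cong suc (∣∣-∩-∁ B F))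

∣∣-modular : ∀ (B F S : Subset m) →
             ∣ B ∩ S ∣ ℕ.+ ∣ B ∩ F ∣ ≡ ∣ B ∩ (S ∩ F) ∣ ℕ.+ ∣ B ∩ (S ∪ F) ∣
∣∣-modular []            []            []            = refl
∣∣-modular (outside ∷ B) (_ ∷ F)       (_ ∷ S)       = ∣∣-modular B F S
∣∣-modular (inside ∷ B)  (outside ∷ F) (outside ∷ S) = ∣∣-modular B F S
∣∣-modular (inside ∷ B)  (outside ∷ F) (inside ∷ S)  =
  trans (cong suc (∣∣-modular B F S)) (sym (ℕₚ.+-suc _ _))
∣∣-modular (inside ∷ B)  (inside ∷ F)  (outside ∷ S) =
  trans (ℕₚ.+-suc _ _) (trans (cong suc (∣∣-modular B F S)) (sym (ℕₚ.+-suc _ _)))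
∣∣-modular (inside ∷ B)  (inside ∷ F)  (inside ∷ S)  =
  cong suc (trans (ℕₚ.+-suc _ _) (trans (cong suc (∣∣-modular B F S)) (sym (ℕₚ.+-suc _ _))))

weight-bump : ∀ (F : Subset m) w B → weight (bump F w) B ≡ ∣ B ∩ F ∣ ℕ.+ weight w B
weight-bump []            []      []            = refl
weight-bump (outside ∷ F) (a ∷ w) (outside ∷ B) = weight-bump F w B
weight-bump (inside ∷ F)  (a ∷ w) (outside ∷ B) = weight-bump F w B
weight-bump (outside ∷ F) (a ∷ w) (inside ∷ B)  =
  trans (cong (a ℕ.+_) (weight-bump F w B)) (x∙yz≈y∙xz a ∣ B ∩ F ∣ (weight w B))
weight-bump (inside ∷ F)  (a ∷ w) (inside ∷ B)  =
  cong suc (trans (cong (a ℕ.+_) (weight-bump F w B)) (x∙yz≈y∙xz a ∣ B ∩ F ∣ (weight w B)))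

SupportedIn : Vec ℕ m → Subset m → Set
SupportedIn w F = ∀ x → x Subset.∉ F → lookup w x ≡ 0

-- Elements outside `F` weigh 0, so only B ∩ F contributes to the weight of `B`.
weight-mono : ∀ (w : Vec ℕ m) F B C → SupportedIn w F → B ∩ F ⊆ C → weight w B ℕ.≤ weight w C
weight-mono []      []      []      []      _    _     = ℕ.z≤n
weight-mono (a ∷ w) (f ∷ F) (b ∷ B) (c ∷ C) supp B∩F⊆C = ℕₚ.+-mono-≤ (head f b supp B∩F⊆C)
  (weight-mono w F B C (λ x x∉F → supp (Fin.suc x) (x∉F ∘ Subsetₚ.drop-there))
    (Subsetₚ.drop-∷-⊆ B∩F⊆C))
  where
  head : ∀ f b → SupportedIn (a ∷ w) (f ∷ F) → (b ∷ B) ∩ (f ∷ F) ⊆ c ∷ C →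
         (if b then a else 0) ℕ.≤ (if c then a else 0)
  head _       outside _    _ = ℕ.z≤n
  head outside inside  supp _ rewrite supp Fin.zero (λ ()) = ℕ.z≤n
  head inside  inside  _    ⊆C with ⊆C Vec.here
  ... | Vec.here = ℕₚ.≤-refl

∣∣-∩-mono : ∀ {B C F G : Subset m} → B ∩ F ⊆ C → G ⊆ F → ∣ B ∩ G ∣ ℕ.≤ ∣ C ∩ G ∣
∣∣-∩-mono {B = B} {G = G} B∩F⊆C G⊆F = Subsetₚ.p⊆q⇒∣p∣≤∣q∣ λ x∈B∩G →
  let x∈B , x∈G = Subsetₚ.x∈p∩q⁻ B G x∈B∩G
  in Subsetₚ.x∈p∩q⁺ (B∩F⊆C (Subsetₚ.x∈p∩q⁺ (x∈B , G⊆F x∈G)) , x∈G)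

∣∣-remove : ∀ (B : Subset m) {x} → x Subset.∈ B → suc ∣ B [ x ]≔ outside ∣ ≡ ∣ B ∣
∣∣-remove (inside ∷ B)  Vec.here        = refl
∣∣-remove (outside ∷ B) (Vec.there x∈B) = ∣∣-remove B x∈B
∣∣-remove (inside ∷ B)  (Vec.there x∈B) = cong suc (∣∣-remove B x∈B)

∣∣-insert : ∀ (B : Subset m) y → y Subset.∉ B → ∣ B [ y ]≔ inside ∣ ≡ suc ∣ B ∣
∣∣-insert (inside ∷ B)  Fin.zero    y∉B = ⊥-elim (y∉B Vec.here)
∣∣-insert (outside ∷ B) Fin.zero    y∉B = refl
∣∣-insert (inside ∷ B)  (Fin.suc y) y∉B = cong suc (∣∣-insert B y (y∉B ∘ Vec.there))
∣∣-insert (outside ∷ B) (Fin.suc y) y∉B = ∣∣-insert B y (y∉B ∘ Vec.there)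

∉-updated : ∀ (B : Subset m) x → x Subset.∉ B [ x ]≔ outside
∉-updated B x x∈ with trans (sym (Vecₚ.[]=⇒lookup x∈)) (Vecₚ.lookup∘update x B outside)
... | ()

∈-update⁻ : ∀ (B : Subset m) {z} x s → z ≢ x → z Subset.∈ B [ x ]≔ s → z Subset.∈ B
∈-update⁻ B {z} x s z≢x z∈ = Vecₚ.lookup⇒[]= z B
  (trans (sym (Vecₚ.lookup∘update′ z≢x B s)) (Vecₚ.[]=⇒lookup z∈))

swap : Subset m → Fin m → Fin m → Subset m
swap B x y = (B [ x ]≔ outside) [ y ]≔ inside

module _ {B : Subset m} {x y : Fin m} where

  ∣∣-swap : x Subset.∈ B → y Subset.∉ B → ∣ swap B x y ∣ ≡ ∣ B ∣
  ∣∣-swap x∈B y∉B = trans (∣∣-insert (B [ x ]≔ outside) y y∉B-x) (∣∣-remove B x∈B)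
    where
    y∉B-x : y Subset.∉ B [ x ]≔ outside
    y∉B-x y∈ = y∉B (∈-update⁻ B x outside (λ { refl → y∉B x∈B }) y∈)

  ∈-swap⁺ : ∀ {z} → z ≢ x → z Subset.∈ B → z Subset.∈ swap B x y
  ∈-swap⁺ {z} z≢x z∈B with z Finₚ.≟ y
  ... | yes refl = Vecₚ.[]≔-updates (B [ x ]≔ outside) z
  ... | no  z≢y  = Vecₚ.[]≔-minimal (B [ x ]≔ outside) z y z≢y (Vecₚ.[]≔-minimal B z x z≢x z∈B)

  ∈-swap⁻ : ∀ {z} → z ≢ y → z Subset.∈ swap B x y → z ≢ x × z Subset.∈ B
  ∈-swap⁻ {z} z≢y z∈ = (λ { refl → ∉-updated B z z∈B-x }) , z∈B
    where
    z∈B-x : z Subset.∈ B [ x ]≔ outside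
    z∈B-x = ∈-update⁻ (B [ x ]≔ outside) y inside z≢y z∈
    z∈B : z Subset.∈ B
    z∈B with z Finₚ.≟ x
    ... | yes refl = ⊥-elim (∉-updated B z z∈B-x)
    ... | no  z≢x  = ∈-update⁻ B x outside z≢x z∈B-x

-- Basis exchange and the ranks of M and of M_w

module MatroidRank (M : Matroid m) where

  private
    β = isBasis M

  r : Subset m → ℕ
  r = rankOf β

  Basis : Subset m → Set
  Basis B = β B ≡ true

  -- Elements of B outside F ∪ B′ are exchanged for elements of B′ until none is left.
  opaque
    exchangeOutside : ∀ F {B B′} → Basis B → Basis B′ →
      ∃ λ C → Basis C × ∣ C ∣ ≡ ∣ B ∣ × B ∩ F ⊆ C × C ∩ ∁ F ⊆ B′
    exchangeOutside F {B} {B′} Bb B′b = go (suc ∣ B ∩ ∁ B′ ∣) B Bb ℕₚ.≤-refl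
      where
      go : ∀ n B → Basis B → ∣ B ∩ ∁ B′ ∣ ℕ.< n →
           ∃ λ C → Basis C × ∣ C ∣ ≡ ∣ B ∣ × B ∩ F ⊆ C × C ∩ ∁ F ⊆ B′
      go (suc n) B Bb bound
        with Finₚ.any? (λ x → (x Subsetₚ.∈? B) ×-dec (¬? (x Subsetₚ.∈? F) ×-dec ¬? (x Subsetₚ.∈? B′)))
      ... | no none = B , Bb , refl , Subsetₚ.p∩q⊆p B F , λ {x} x∈ →
        let x∈B , x∈∁F = Subsetₚ.x∈p∩q⁻ B (∁ F) x∈
        in decidable-stable (x Subsetₚ.∈? B′) λ x∉B′ → none (x , x∈B , Subsetₚ.x∈∁p⇒x∉p x∈∁F , x∉B′)
      ... | yes (x , x∈B , x∉F , x∉B′) with exchange M B B′ x Bb B′b x∈B x∉B′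
      ...   | y , y∈B′ , y∉B , B₁b with go n (swap B x y) B₁b
                (ℕₚ.<-≤-trans (Subsetₚ.p⊂q⇒∣p∣<∣q∣ closer) (ℕₚ.≤-pred bound))
        where
        closer : swap B x y ∩ ∁ B′ Subset.⊂ B ∩ ∁ B′
        closer =
          (λ {z} z∈ → let z∈B₁ , z∈∁B′ = Subsetₚ.x∈p∩q⁻ (swap B x y) (∁ B′) z∈ in
            Subsetₚ.x∈p∩q⁺ (proj₂ (∈-swap⁻ {B = B} {x} {y}
              (λ { refl → Subsetₚ.x∈∁p⇒x∉p z∈∁B′ y∈B′ }) z∈B₁) , z∈∁B′)) ,
          x , Subsetₚ.x∈p∩q⁺ (x∈B , Subsetₚ.x∉p⇒x∈∁p x∉B′) ,
          λ x∈ → proj₁ (∈-swap⁻ {B = B} {x} {y} (λ { refl → x∉B′ y∈B′ })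
                   (proj₁ (Subsetₚ.x∈p∩q⁻ (swap B x y) (∁ B′) x∈))) refl
      ...     | C , Cb , ∣C∣ , B₁∩F⊆C , C∖F⊆B′ =
        C , Cb , trans ∣C∣ (∣∣-swap {B = B} x∈B y∉B) , (λ {z} z∈ →
          let z∈B , z∈F = Subsetₚ.x∈p∩q⁻ B F z∈ in
          B₁∩F⊆C (Subsetₚ.x∈p∩q⁺ (∈-swap⁺ {B = B} (λ { refl → x∉F z∈F }) z∈B , z∈F))) , C∖F⊆B′

  -- With `F` empty, exchange turns `B` into a basis of equal size inside `B′`.
  ∣∣-basis-≤ : ∀ {B B′} → Basis B → Basis B′ → ∣ B ∣ ℕ.≤ ∣ B′ ∣
  ∣∣-basis-≤ {B} {B′} Bb B′b with exchangeOutside ⊥ Bb B′b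
  ... | C , _ , ∣C∣ , _ , C⊆B′ = subst (ℕ._≤ ∣ B′ ∣) ∣C∣
    (Subsetₚ.p⊆q⇒∣p∣≤∣q∣ λ x∈C → C⊆B′ (Subsetₚ.x∈p∩q⁺ (x∈C , Subsetₚ.x∉p⇒x∈∁p Subsetₚ.∉⊥)))

  ∣∣-basis : ∀ {B B′} → Basis B → Basis B′ → ∣ B ∣ ≡ ∣ B′ ∣
  ∣∣-basis Bb B′b = ℕₚ.≤-antisym (∣∣-basis-≤ Bb B′b) (∣∣-basis-≤ B′b Bb)

  r-upper : ∀ S {B} → Basis B → ∣ B ∩ S ∣ ℕ.≤ r S
  r-upper S = max-upper β (λ B → ∣ B ∩ S ∣)

  opaque
    r-attained : ∀ S → ∃ λ B → Basis B × ∣ B ∩ S ∣ ≡ r S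
    r-attained S = max-attained β (λ B → ∣ B ∩ S ∣) (nonempty M)

  opaque
    -- Let `B′` attain r F and exchange `B` towards `B′` outside `F`. The result `C` has no more
    -- elements outside `F` than `B′` and as many in all, hence at least r F inside `F`.
    extend : ∀ F {B} → Basis B → ∃ λ C → Basis C × B ∩ F ⊆ C × ∣ C ∩ F ∣ ≡ r F
    extend F {B} Bb with r-attained F
    ... | B′ , B′b , B′F with exchangeOutside F Bb B′b
    ... | C , Cb , _ , B∩F⊆C , C∖F⊆B′ = C , Cb , (λ {x} → B∩F⊆C {x}) , ℕₚ.≤-antisym (r-upper F Cb)
      (subst (ℕ._≤ ∣ C ∩ F ∣) B′F (ℕₚ.+-cancelʳ-≤ ∣ B′ ∩ ∁ F ∣ _ _ (subst (ℕ._≤ ∣ C ∩ F ∣ ℕ.+ ∣ B′ ∩ ∁ F ∣)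
        (trans (∣∣-∩-∁ C F) (trans (∣∣-basis Cb B′b) (sym (∣∣-∩-∁ B′ F))))
        (ℕₚ.+-monoʳ-≤ ∣ C ∩ F ∣ C∖F≤B′∖F))))
      where
      C∖F≤B′∖F : ∣ C ∩ ∁ F ∣ ℕ.≤ ∣ B′ ∩ ∁ F ∣
      C∖F≤B′∖F = Subsetₚ.p⊆q⇒∣p∣≤∣q∣ λ x∈ →
        Subsetₚ.x∈p∩q⁺ (C∖F⊆B′ x∈ , proj₂ (Subsetₚ.x∈p∩q⁻ C (∁ F) x∈))

  wt : Vec ℕ m → ℕ
  wt = wtOf β

  wt-upper : ∀ w {B} → Basis B → weight w B ℕ.≤ wt w
  wt-upper w = max-upper β (weight w)

  record MaxBasis (w : Vec ℕ m) (B : Subset m) : Set where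
    constructor _,_
    field
      basis   : Basis B
      maximal : weight w B ≡ wt w

  open MaxBasis

  opaque
    maxBasis : ∀ w → ∃ (MaxBasis w)
    maxBasis w = let B , Bb , e = max-attained β (weight w) (nonempty M) in B , (Bb , e)

  rk : Vec ℕ m → Subset m → ℕ
  rk w = rankOf (restrictW β w)

  rk-upper : ∀ w S {B} → MaxBasis w B → ∣ B ∩ S ∣ ℕ.≤ rk w S
  rk-upper w S (Bb , e) = max-upper (restrictW β w) (λ B → ∣ B ∩ S ∣) (restrictW⁺ β w Bb e)

  opaque
    rk-attained : ∀ w S → ∃ λ B → MaxBasis w B × ∣ B ∩ S ∣ ≡ rk w S
    rk-attained w S =
      let C , Cb , e = max-attained β (weight w) (nonempty M)
          B , Bw , BS = max-attained (restrictW β w) (λ B → ∣ B ∩ S ∣) (C , restrictW⁺ β w Cb e)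
          Bb , wB = restrictW⁻ β w Bw
      in B , (Bb , wB) , BS

  rk-⊤ : ∀ w → rk w ⊤ ≡ r ⊤
  rk-⊤ w with rk-attained w ⊤ | r-attained ⊤
  ... | B , (Bb , _) , e | C , Cb , e′ = trans (sym e) (trans
    (cong ∣_∣ (Subsetₚ.∩-identityʳ B)) (trans (∣∣-basis Bb Cb)
    (trans (cong ∣_∣ (sym (Subsetₚ.∩-identityʳ C))) e′)))

  opaque
    -- For `w` supported in `F`, a basis that contains B ∩ F weighs at least as much as `B`. So
    -- maximal weight and maximal intersection with `F` can be had together, which is the crux of
    -- the formulas for 1_F + w.
    extendMax : ∀ w F {B} → SupportedIn w F → MaxBasis w B →
                ∃ λ C → MaxBasis w C × B ∩ F ⊆ C × ∣ C ∩ F ∣ ≡ r F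
    extendMax w F {B} supp (Bb , wB) with extend F Bb
    ... | C , Cb , B∩F⊆C , CF = C , (Cb , ℕₚ.≤-antisym (wt-upper w Cb)
          (subst (ℕ._≤ weight w C) wB (weight-mono w F B C supp B∩F⊆C))) , (λ {x} → B∩F⊆C {x}) , CF

  module _ {w : Vec ℕ m} {F : Subset m} (supp : SupportedIn w F) where

    -- The weight of `B` is |B ∩ F| plus its `w`-weight. Each part is bounded by its own maximum,
    -- and `extendMax` attains both at once.
    wt-bump : wt (bump F w) ≡ r F ℕ.+ wt w
    wt-bump = ℕₚ.≤-antisym upper lower
      where
      upper : wt (bump F w) ℕ.≤ r F ℕ.+ wt w
      upper with maxBasis (bump F w)
      ... | B , (Bb , e) = subst (ℕ._≤ r F ℕ.+ wt w) (trans (sym (weight-bump F w B)) e)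
              (ℕₚ.+-mono-≤ (r-upper F Bb) (wt-upper w Bb))
      lower : r F ℕ.+ wt w ℕ.≤ wt (bump F w)
      lower with maxBasis w
      ... | B , Bw with extendMax w F supp Bw
      ... | C , (Cb , wC) , _ , CF = subst (ℕ._≤ wt (bump F w))
              (trans (weight-bump F w C) (cong₂ ℕ._+_ CF wC)) (wt-upper (bump F w) Cb)

    maxBasis-bump⁺ : ∀ {B} → MaxBasis w B → ∣ B ∩ F ∣ ≡ r F → MaxBasis (bump F w) B
    maxBasis-bump⁺ {B} (Bb , wB) BF =
      Bb , trans (weight-bump F w B) (trans (cong₂ ℕ._+_ BF wB) (sym wt-bump))

    -- Neither summand can exceed its maximum, so a maximal sum forces both to be maximal.
    maxBasis-bump⁻ : ∀ {B} → MaxBasis (bump F w) B → MaxBasis w B × ∣ B ∩ F ∣ ≡ r F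
    maxBasis-bump⁻ {B} (Bb , wB) = (Bb , wB′) ,
      ℕₚ.+-cancelʳ-≡ (wt w) _ _ (trans (cong (∣ B ∩ F ∣ ℕ.+_) (sym wB′)) total)
      where
      total : ∣ B ∩ F ∣ ℕ.+ weight w B ≡ r F ℕ.+ wt w
      total = trans (sym (weight-bump F w B)) (trans wB wt-bump)
      wB′ : weight w B ≡ wt w
      wB′ = ℕₚ.≤-antisym (wt-upper w Bb) (ℕₚ.+-cancelˡ-≤ (r F) _ _
        (subst (ℕ._≤ r F ℕ.+ weight w B) total (ℕₚ.+-monoˡ-≤ (weight w B) (r-upper F Bb))))

    -- The rank function of the direct sum of (M|F)_w and M/F. Both inequalities come from the
    -- modularity of S ↦ |B ∩ S| for a single basis; the lower one needs a basis that attains all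
    -- the ranks involved.
    rk-bump : ∀ S → rk (bump F w) S ℕ.+ r F ≡ rk w (S ∩ F) ℕ.+ r (S ∪ F)
    rk-bump S = ℕₚ.≤-antisym upper lower
      where
      upper : rk (bump F w) S ℕ.+ r F ℕ.≤ rk w (S ∩ F) ℕ.+ r (S ∪ F)
      upper with rk-attained (bump F w) S
      ... | B , Bw , BS with maxBasis-bump⁻ Bw
      ... | Bw′ , BF = subst (ℕ._≤ rk w (S ∩ F) ℕ.+ r (S ∪ F))
              (trans (sym (∣∣-modular B F S)) (cong₂ ℕ._+_ BS BF))
              (ℕₚ.+-mono-≤ (rk-upper w (S ∩ F) Bw′) (r-upper (S ∪ F) (basis Bw)))
      lower : rk w (S ∩ F) ℕ.+ r (S ∪ F) ℕ.≤ rk (bump F w) S ℕ.+ r F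
      lower with rk-attained w (S ∩ F)
      -- `B` attains rk_w on S ∩ F; `C` keeps this and attains r on F; `D` keeps both and attains r
      -- on S ∪ F.
      ... | B , Bw , BSF with extendMax w F supp Bw
      ... | C , Cw , B∩F⊆C , CF
        with extendMax w (S ∪ F) (λ x x∉ → supp x (x∉ ∘ Subsetₚ.q⊆p∪q S F)) Cw
      ... | D , Dw , C∩SF⊆D , DSF = ℕₚ.≤-trans
        (ℕₚ.+-mono-≤ (subst (ℕ._≤ ∣ D ∩ (S ∩ F) ∣) BSF (ℕₚ.≤-trans
            (∣∣-∩-mono {B = B} {C} B∩F⊆C (Subsetₚ.p∩q⊆q S F))
            (∣∣-∩-mono {B = C} {D} C∩SF⊆D (Subsetₚ.q⊆p∪q S F ∘ Subsetₚ.p∩q⊆q S F))))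
          (ℕₚ.≤-reflexive (sym DSF)))
        (subst (ℕ._≤ rk (bump F w) S ℕ.+ r F) (∣∣-modular D F S)
          (ℕₚ.+-mono-≤ (rk-upper (bump F w) S (maxBasis-bump⁺ Dw DF)) (ℕₚ.≤-reflexive DF)))
        where
        DF : ∣ D ∩ F ∣ ≡ r F
        DF = ℕₚ.≤-antisym (r-upper F (basis Dw))
          (subst (ℕ._≤ ∣ D ∩ F ∣) CF (∣∣-∩-mono {B = C} {D} C∩SF⊆D (Subsetₚ.q⊆p∪q S F)))

-- Recurrences over the Boolean lattice

module _ (r : Subset m → ℕ) where

  Recurrence : (Subset m → Series) → Set
  Recurrence f = ∀ S i j →
    ∑ (below S) (λ A → sgn A * f A i j) ≡
    ∑ (below S) (λ F → sgn F * f F (i + + r S) (j - + ∣ F ∣))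

  -- F ↦ T^{-∣F∣} f_F(q⁻¹ , T⁻¹)
  dual : (Subset m → Series) → Subset m → Series
  dual f F i j = f F (- i) (- (j + + ∣ F ∣))

  recurrence-dual : ∀ {f} → Recurrence f → Recurrence (dual f)
  recurrence-dual {f} rec S i j = begin
    ∑ (below S) (λ A → sgn A * f A (- i) (- (j + + ∣ A ∣)))
      ≡⟨ ∑-ext (below S) (λ A → cong (_*_ (sgn A)) (cong₂ (f A) (shift-q i (+ r S)) (shift-T j (+ ∣ A ∣)))) ⟩
    ∑ (below S) (λ F → sgn F * f F (- (i + + r S) + + r S) (- j - + ∣ F ∣))
      ≡⟨ rec S (- (i + + r S)) (- j) ⟨
    ∑ (below S) (λ A → sgn A * f A (- (i + + r S)) (- j))
      ≡⟨ ∑-ext (below S) (λ A → cong (_*_ (sgn A)) (cong (f A (- (i + + r S))) (unshift-T j (+ ∣ A ∣)))) ⟨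
    ∑ (below S) (λ F → sgn F * f F (- (i + + r S)) (- ((j - + ∣ F ∣) + + ∣ F ∣))) ∎
    where
    shift-q : ∀ i x → - i ≡ - (i + x) + x
    shift-q = solve-∀
    shift-T : ∀ j x → - (j + x) ≡ - j - x
    shift-T = solve-∀
    unshift-T : ∀ j x → - ((j - x) + x) ≡ - j
    unshift-T = solve-∀

  private
    diagonal : Subset m → Poly2
    diagonal S = binom (- + r S) (+ ∣ S ∣)

    lower : Subset m → Subset m → Poly2
    lower S F = (sgn S * sgn F , - + r S , + ∣ F ∣) ∷ (- (sgn S * sgn F) , + 0 , + 0) ∷ []

    solveFor : ∀ s x x′ a b → s * s ≡ + 1 → s * x + a ≡ s * x′ + b → x - x′ ≡ s * (b - a)
    solveFor s x x′ a b s² e = begin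
      x - x′                                  ≡⟨ ℤₚ.*-identityˡ _ ⟨
      + 1 * (x - x′)                          ≡⟨ cong (_* (x - x′)) s² ⟨
      s * s * (x - x′)                        ≡⟨ expand s x x′ a ⟩
      s * ((s * x + a) - (s * x′) - a)        ≡⟨ cong (λ y → s * (y - s * x′ - a)) e ⟩
      s * ((s * x′ + b) - (s * x′) - a)       ≡⟨ collapse s x′ a b ⟩
      s * (b - a)                             ∎
      where
      expand : ∀ s x x′ a → s * s * (x - x′) ≡ s * ((s * x + a) - (s * x′) - a)
      expand = solve-∀
      collapse : ∀ s x′ a b → s * ((s * x′ + b) - (s * x′) - a) ≡ s * (b - a)
      collapse = solve-∀

  recurrence-solve : ∀ {f} → Recurrence f → ∀ S →
    diagonal S ▷ f S ≐ λ i j → ∑ (properBelow S) (λ F → (lower S F ▷ f F) i j)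
  recurrence-solve {f} rec S i j = begin
    (diagonal S ▷ f S) i j
      ≡⟨ binom-▷ (- + r S) (+ ∣ S ∣) (f S) i j ⟩
    f S i j - f S (i - - + r S) (j - + ∣ S ∣)
      ≡⟨ cong (λ x → f S i j - f S x (j - + ∣ S ∣)) (cong (_+_ i) (ℤₚ.neg-involutive (+ r S))) ⟩
    f S i j - f S (i + + r S) (j - + ∣ S ∣)
      ≡⟨ solveFor (sgn S) _ _ (∑ (properBelow S) here-term) (∑ (properBelow S) shifted-term) (sign² ∣ S ∣)
           (subst (λ xs → ∑ xs here-term ≡ ∑ xs shifted-term) (below≡self∷proper S) (rec S i j)) ⟩
    sgn S * (∑ (properBelow S) shifted-term - ∑ (properBelow S) here-term)
      ≡⟨ cong (λ x → sgn S * (∑ (properBelow S) shifted-term + x)) (∑-neg (properBelow S) here-term) ⟨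
    sgn S * (∑ (properBelow S) shifted-term + ∑ (properBelow S) (λ F → - here-term F))
      ≡⟨ cong (_*_ (sgn S)) (∑-+ (properBelow S) _ _) ⟨
    sgn S * ∑ (properBelow S) (λ F → shifted-term F + - here-term F)
      ≡⟨ ∑-*ˡ (properBelow S) (sgn S) _ ⟨
    ∑ (properBelow S) (λ F → sgn S * (shifted-term F + - here-term F))
      ≡⟨ ∑-ext (properBelow S) (λ F → trans (rearrange (sgn S) (sgn F) _ _) (sym (cong₂
           (λ x y → sgn S * sgn F * x + (- (sgn S * sgn F) * y + + 0))
           (cong (λ x → f F x (j - + ∣ F ∣)) (cong (_+_ i) (ℤₚ.neg-involutive (+ r S))))
           (cong₂ (f F) (ℤₚ.+-identityʳ i) (ℤₚ.+-identityʳ j))))) ⟩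
    ∑ (properBelow S) (λ F → (lower S F ▷ f F) i j) ∎
    where
    here-term shifted-term : Subset m → ℤ
    here-term F    = sgn F * f F i j
    shifted-term F = sgn F * f F (i + + r S) (j - + ∣ F ∣)
    rearrange : ∀ s t x y → s * (t * x + - (t * y)) ≡ s * t * x + (- (s * t) * y + + 0)
    rearrange = solve-∀

  -- Strong induction on #S. The values agree only as rational functions, since `f` and `g` may be
  -- expansions at different points. The case of the empty set is a hypothesis: for a rank function
  -- the recurrence is a tautology there.
  recurrence-unique : ∀ {f g} → Recurrence f → Recurrence g →
    (∀ S → ∣ S ∣ ≡ 0 → SameRational (f S) (g S)) → ∀ S → SameRational (f S) (g S)
  recurrence-unique {f} {g} rec-f rec-g base S = go (suc ∣ S ∣) S ℕₚ.≤-refl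
    where
    go : ∀ n S → ∣ S ∣ ℕ.< n → SameRational (f S) (g S)
    go (suc n) S bound with ∣ S ∣ ℕₚ.≟ 0
    ... | yes ∣S∣≡0 = base S ∣S∣≡0
    ... | no  ∣S∣≢0 = SameRational-÷ (diagonal S)
      -- It is the exponent of T that is known to be nonzero; the exponent of q vanishes when `S`
      -- consists of loops.
      (Regular-binom (- + r S) (+ ∣ S ∣) (inj₂ (∣S∣≢0 ∘ ℤₚ.+-injective)))
      (SameRational-≐ (≐-sym (recurrence-solve rec-f S)) (≐-sym (recurrence-solve rec-g S))
        (SameRational-∑ (properBelow S) _ _ λ {F} F∈ → SameRational-▷ (lower S F)
          (go n F (ℕₚ.<-≤-trans (properBelow-∣∣ S F∈) (ℕₚ.≤-pred bound)))))

-- The series Y_A and their recurrence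

box-supported : ∀ N (F : Subset m) {w} → w ∈ box N F → SupportedIn w F
box-supported N []            w∈ ()
box-supported N (outside ∷ F) w∈ with ∈ₚ.∈-map⁻ (0 ∷_) w∈
... | _ , w′∈ , refl = λ
  { Fin.zero _      → refl
  ; (Fin.suc x) x∉F → box-supported N F w′∈ x (x∉F ∘ Vec.there) }
box-supported N (inside ∷ F)  w∈ with ∈ₚ.∈-concatMap⁻ (λ a → map (a ∷_) (box N F)) {xs = upTo N} w∈
... | a∈ with Anyₚ.satisfied a∈
... | a , w∈a with ∈ₚ.∈-map⁻ (a ∷_) w∈a
... | _ , w′∈ , refl = λ
  { Fin.zero 0∉F    → ⊥-elim (0∉F Vec.here)
  ; (Fin.suc x) x∉F → box-supported N F w′∈ x (x∉F ∘ Vec.there) }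

box-∅ : ∀ N N′ (F : Subset m) → ∣ F ∣ ≡ 0 → box N F ≡ box N′ F
box-∅ N N′ []            _ = refl
box-∅ N N′ (outside ∷ F) e = cong (map (0 ∷_)) (box-∅ N N′ F e)

sumℕ-bump : ∀ (F : Subset m) w → sumℕ (bump F w) ≡ ∣ F ∣ ℕ.+ sumℕ w
sumℕ-bump []            []      = refl
sumℕ-bump (outside ∷ F) (a ∷ w) =
  trans (cong (a ℕ.+_) (sumℕ-bump F w)) (x∙yz≈y∙xz a ∣ F ∣ (sumℕ w))
sumℕ-bump (inside ∷ F)  (a ∷ w) =
  cong suc (trans (cong (a ℕ.+_) (sumℕ-bump F w)) (x∙yz≈y∙xz a ∣ F ∣ (sumℕ w)))

δ₁-negative : ∀ {j} n → j ℤ.< + 0 → δ₁ (j - + n) ≡ + 0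
δ₁-negative {j} n j<0 = δ₁-off λ e →
  ℤₚ.≤⇒≯ (ℤ.+≤+ ℕ.z≤n) (subst (ℤ._< + 0) (ℤₚ.i-j≡0⇒i≡j j (+ n) e) j<0)

module MatroidSeries (M : Matroid m) where

  open MatroidRank M

  exponent : Vec ℕ m → Subset m → ℕ
  exponent w R = rk w R ℕ.+ wt w

  -- The r F from `wt-bump` cancels the one from `rk-bump`. Only R ∪ F and R ∩ F survive, which is
  -- the form that `∑-below²` reindexes.
  exponent-bump : ∀ {w F} → SupportedIn w F → ∀ R →
                  exponent (bump F w) R ≡ r (R ∪ F) ℕ.+ exponent w (R ∩ F)
  exponent-bump {w} {F} supp R = begin
    rk (bump F w) R ℕ.+ wt (bump F w)            ≡⟨ cong (rk (bump F w) R ℕ.+_) (wt-bump supp) ⟩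
    rk (bump F w) R ℕ.+ (r F ℕ.+ wt w)           ≡⟨ ℕₚ.+-assoc (rk (bump F w) R) (r F) (wt w) ⟨
    (rk (bump F w) R ℕ.+ r F) ℕ.+ wt w           ≡⟨ cong (ℕ._+ wt w) (rk-bump supp R) ⟩
    (rk w (R ∩ F) ℕ.+ r (R ∪ F)) ℕ.+ wt w        ≡⟨ cong (ℕ._+ wt w) (ℕₚ.+-comm (rk w (R ∩ F)) _) ⟩
    (r (R ∪ F) ℕ.+ rk w (R ∩ F)) ℕ.+ wt w        ≡⟨ ℕₚ.+-assoc (r (R ∪ F)) _ _ ⟩
    r (R ∪ F) ℕ.+ (rk w (R ∩ F) ℕ.+ wt w)        ∎

  term : Vec ℕ m → Subset m → Series
  term w R i j = sgn R * δ (i + + exponent w R) (j - + sumℕ w)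

  term-bump : ∀ {w F} → SupportedIn w F → ∀ R i j →
    term (bump F w) R i j ≡
    sgn (R ∪ F) * (sgn F * term w (R ∩ F) (i + + r (R ∪ F)) (j - + ∣ F ∣))
  term-bump {w} {F} supp R i j = trans
    (cong₂ _*_ (sgn-∩-∪ F R) (cong₂ δ
      (trans (cong (λ e → i + + e) (exponent-bump supp R)) (+-+ i _ _))
      (trans (cong (λ e → j - + e) (sumℕ-bump F w)) (-+ j _ _))))
    (reassoc (sgn (R ∪ F)) (sgn F) _ _)
    where
    +-+ : ∀ i a b → i + + (a ℕ.+ b) ≡ i + + a + + b
    +-+ i a b = trans (cong (_+_ i) (ℤₚ.pos-+ a b)) (sym (ℤₚ.+-assoc i (+ a) (+ b)))
    -+′ : ∀ x y z → x - (y + z) ≡ x - y - z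
    -+′ = solve-∀
    -+ : ∀ j a b → j - + (a ℕ.+ b) ≡ j - + a - + b
    -+ j a b = trans (cong (_-_ j) (ℤₚ.pos-+ a b)) (-+′ j (+ a) (+ b))
    reassoc : ∀ a b c d → a * (b * c) * d ≡ a * (b * (c * d))
    reassoc = solve-∀

  -- Y_A truncated to the weights with entries below `N`, so that every coefficient is a finite sum.
  Yᵗ : ℕ → Subset m → Series
  Yᵗ N A i j = ∑ (box N A) (λ w → ∑ (below A) (λ R → term w R i j))

  Yᵗ-suc : ∀ N A i j → Yᵗ (suc N) A i j ≡
    ∑ (below A) (λ S → sgn S * ∑ (below S) (λ F → sgn F * Yᵗ N F (i + + r S) (j - + ∣ F ∣)))
  Yᵗ-suc N A i j = begin
    ∑ (box (suc N) A) (λ w → ∑ (below A) (λ R → term w R i j))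
      ≡⟨ ∑-box-suc N A _ ⟩
    ∑ (below A) (λ F → ∑ (box N F) (λ w → ∑ (below A) (λ R → term (bump F w) R i j)))
      ≡⟨ ∑-ext (below A) (λ F → trans
           (∑-cong (box N F) (λ w∈ → ∑-ext (below A) (λ R → term-bump (box-supported N F w∈) R i j)))
           (∑-swap (box N F) (below A) _)) ⟩
    ∑ (below A) (λ F → ∑ (below A) (λ R → inner F (R ∩ F) (R ∪ F)))
      ≡⟨ ∑-below² A inner ⟩
    ∑ (below A) (λ S → ∑ (below S) (λ F → ∑ (below F) (λ R → inner F R S)))
      ≡⟨ ∑-ext (below A) (λ S → trans (∑-ext (below S) (factor S)) (∑-*ˡ (below S) (sgn S) _)) ⟩
    ∑ (below A) (λ S → sgn S * ∑ (below S) (λ F → sgn F * Yᵗ N F (i + + r S) (j - + ∣ F ∣))) ∎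
    where
    inner : Subset m → Subset m → Subset m → ℤ
    inner F R S = ∑ (box N F) (λ w → sgn S * (sgn F * term w R (i + + r S) (j - + ∣ F ∣)))
    factor : ∀ S F → ∑ (below F) (λ R → inner F R S) ≡
                     sgn S * (sgn F * Yᵗ N F (i + + r S) (j - + ∣ F ∣))
    factor S F = begin
      ∑ (below F) (λ R → inner F R S)
        ≡⟨ ∑-swap (below F) (box N F) _ ⟩
      ∑ (box N F) (λ w → ∑ (below F) (λ R → sgn S * (sgn F * term w R (i + + r S) (j - + ∣ F ∣))))
        ≡⟨ ∑-ext (box N F) (λ w → trans (∑-*ˡ (below F) (sgn S) _) (cong (_*_ (sgn S)) (∑-*ˡ (below F) (sgn F) _))) ⟩
      ∑ (box N F) (λ w → sgn S * (sgn F * ∑ (below F) (λ R → term w R (i + + r S) (j - + ∣ F ∣))))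
        ≡⟨ trans (∑-*ˡ (box N F) (sgn S) _) (cong (_*_ (sgn S)) (∑-*ˡ (box N F) (sgn F) _)) ⟩
      sgn S * (sgn F * Yᵗ N F (i + + r S) (j - + ∣ F ∣)) ∎

  -- The truncations on the two sides differ by one, so this becomes a recurrence for a single
  -- family only where the coefficients have stabilised.
  Yᵗ-recurrence : ∀ N S i j →
    ∑ (below S) (λ A → sgn A * Yᵗ (suc N) A i j) ≡
    ∑ (below S) (λ F → sgn F * Yᵗ N F (i + + r S) (j - + ∣ F ∣))
  Yᵗ-recurrence N S i j = begin
    ∑ (below S) (λ A → sgn A * Yᵗ (suc N) A i j)
      ≡⟨ ∑-ext (below S) (λ A → cong (_*_ (sgn A)) (Yᵗ-suc N A i j)) ⟩
    ∑ (below S) (λ A → sgn A * ∑ (below A) (λ S → sgn S * shifted S))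
      -- The inverted function carries a sign of its own, and the two signs multiply to 1.
      ≡⟨ möbius S (λ S → sgn S * shifted S) ⟩
    sgn S * (sgn S * shifted S)
      ≡⟨ ℤₚ.*-assoc (sgn S) (sgn S) (shifted S) ⟨
    sgn S * sgn S * shifted S
      ≡⟨ cong (_* shifted S) (sign² ∣ S ∣) ⟩
    + 1 * shifted S
      ≡⟨ ℤₚ.*-identityˡ (shifted S) ⟩
    shifted S ∎
    where
    shifted : Subset m → ℤ
    shifted S = ∑ (below S) (λ F → sgn F * Yᵗ N F (i + + r S) (j - + ∣ F ∣))

  Yᵗ-negative : ∀ N A i {j} → j ℤ.< + 0 → Yᵗ N A i j ≡ + 0
  Yᵗ-negative N A i {j} j<0 = trans
    (∑-ext (box N A) (λ w → trans (∑-ext (below A) (λ R → term≡0 w R)) (∑-zero (below A))))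
    (∑-zero (box N A))
    where
    term≡0 : ∀ w R → term w R i j ≡ + 0
    term≡0 w R = trans (cong (_*_ (sgn R)) (trans
      (cong (_*_ (δ₁ (i + + exponent w R))) (δ₁-negative (sumℕ w) j<0))
      (ℤₚ.*-zeroʳ (δ₁ (i + + exponent w R))))) (ℤₚ.*-zeroʳ (sgn R))

  -- Induction through `Yᵗ-suc`: a nonempty `F` lowers `j` by at least 1, so the bound for `N`
  -- applies. The empty `F` leaves `j` alone, but its box is the same for every `N`. At N = 0 both
  -- coefficients sit at a negative power of T and vanish.
  Yᵗ-stable : ∀ N A i {j} → j ℤ.< + N → Yᵗ N A i j ≡ Yᵗ (suc N) A i j
  Yᵗ-stable zero    A i j<0 = trans (Yᵗ-negative 0 A i j<0) (sym (Yᵗ-negative 1 A i j<0))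
  Yᵗ-stable (suc N) A i {j} j<N = begin
    Yᵗ (suc N) A i j
      ≡⟨ Yᵗ-suc N A i j ⟩
    ∑ (below A) (λ S → sgn S * ∑ (below S) (λ F → sgn F * Yᵗ N F (i + + r S) (j - + ∣ F ∣)))
      ≡⟨ ∑-ext (below A) (λ S → cong (_*_ (sgn S)) (∑-ext (below S) (λ F → cong (_*_ (sgn F)) (step F (i + + r S))))) ⟩
    ∑ (below A) (λ S → sgn S * ∑ (below S) (λ F → sgn F * Yᵗ (suc N) F (i + + r S) (j - + ∣ F ∣)))
      ≡⟨ Yᵗ-suc (suc N) A i j ⟨
    Yᵗ (suc (suc N)) A i j ∎
    where
    decrease : ∀ f → j - + suc f ℤ.< + N
    decrease f = ℤₚ.<-≤-trans (ℤₚ.+-monoˡ-< -[1+ f ] j<N) 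
      (subst (ℤ._≤ + N) (sym (ℤₚ.[1+m]⊖[1+n]≡m⊖n N f)) (ℤₚ.m⊖n≤m N f))
    step : ∀ F i → Yᵗ N F i (j - + ∣ F ∣) ≡ Yᵗ (suc N) F i (j - + ∣ F ∣)
    step F i with ∣ F ∣ in ∣F∣≡
    ... | zero  = cong (λ ws → ∑ ws (λ w → ∑ (below F) (λ R → term w R i (j - + 0)))) (box-∅ N (suc N) F ∣F∣≡)
    ... | suc f = Yᵗ-stable N F i (decrease f)

  Yᵗ-stable⁺ : ∀ k N A i {j} → j ℤ.< + N → Yᵗ N A i j ≡ Yᵗ (k ℕ.+ N) A i j
  Yᵗ-stable⁺ zero    N A i j<N = refl
  Yᵗ-stable⁺ (suc k) N A i j<N = trans (Yᵗ-stable⁺ k N A i j<N)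
    (Yᵗ-stable (k ℕ.+ N) A i (ℤₚ.<-≤-trans j<N (ℤ.+≤+ (ℕₚ.m≤n+m N k))))

  Yᵗ-independent : ∀ N N′ A i {j} → j ℤ.< + N → j ℤ.< + N′ → Yᵗ N A i j ≡ Yᵗ N′ A i j
  Yᵗ-independent N N′ A i {j} j<N j<N′ = begin
    Yᵗ N A i j             ≡⟨ Yᵗ-stable⁺ N′ N A i j<N ⟩
    Yᵗ (N′ ℕ.+ N) A i j    ≡⟨ cong (λ k → Yᵗ k A i j) (ℕₚ.+-comm N′ N) ⟩
    Yᵗ (N ℕ.+ N′) A i j    ≡⟨ Yᵗ-stable⁺ N N′ A i j<N′ ⟨
    Yᵗ N′ A i j            ∎

  -- Σ_{w ∈ ℕ^A} Σ_{R ⊆ A} (-1)^{#R} q^{-rk_w R - wt w} T^{Σ w}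
  Y : Subset m → Series
  Y A i j = Yᵗ (suc ℤ.∣ j ∣) A i j

  j<suc∣j∣ : ∀ j → j ℤ.< + suc ℤ.∣ j ∣
  j<suc∣j∣ (+ n)    = ℤ.+<+ ℕₚ.≤-refl
  j<suc∣j∣ -[1+ n ] = ℤ.-<+

  Y≡Yᵗ : ∀ N A i {j} → j ℤ.< + N → Y A i j ≡ Yᵗ N A i j
  Y≡Yᵗ N A i {j} j<N = Yᵗ-independent (suc ℤ.∣ j ∣) N A i (j<suc∣j∣ j) j<N

  Y-recurrence : Recurrence r Y
  Y-recurrence S i j = begin
    ∑ (below S) (λ A → sgn A * Y A i j)
      ≡⟨ ∑-ext (below S) (λ A → cong (_*_ (sgn A)) (Yᵗ-stable N A i (j<suc∣j∣ j))) ⟩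
    ∑ (below S) (λ A → sgn A * Yᵗ (suc N) A i j)
      ≡⟨ Yᵗ-recurrence N S i j ⟩
    ∑ (below S) (λ F → sgn F * Yᵗ N F (i + + r S) (j - + ∣ F ∣))
      ≡⟨ ∑-ext (below S) (λ F → cong (_*_ (sgn F)) (Y≡Yᵗ N F (i + + r S)
           (ℤₚ.≤-<-trans (ℤₚ.i-j≤i j (+ ∣ F ∣)) (j<suc∣j∣ j)))) ⟨
    ∑ (below S) (λ F → sgn F * Y F (i + + r S) (j - + ∣ F ∣)) ∎
    where
    N = suc ℤ.∣ j ∣

-- Coefficients of the reduced zeta function

-- The coefficient at q^x of a polynomial whose list starts in degree `o`; `x` is any integer, so
-- that shifts need no case distinction.
coeffFrom : ℕ → List ℤ → ℤ → ℤ
coeffFrom o []       x = + 0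
coeffFrom o (a ∷ as) x = a * δ₁ (x - + o) + coeffFrom (suc o) as x

∑-indexed : ∀ o (f : ℕ → ℕ) → (∀ k → f k ≡ k ℕ.+ o) → ∀ as x →
  ∑ (zip (applyUpTo f (length as)) as) (λ p → proj₂ p * δ₁ (x - + proj₁ p)) ≡ coeffFrom o as x
∑-indexed o f f≡ []       x = refl
∑-indexed o f f≡ (a ∷ as) x = cong₂ _+_
  (cong (λ k → a * δ₁ (x - + k)) (f≡ 0))
  (∑-indexed (suc o) (f ∘ suc) (λ k → trans (f≡ (suc k)) (sym (ℕₚ.+-suc k o))) as x)

coeffFrom-map : ∀ o (f : ℕ → ℕ) → (∀ k → f k ≡ k ℕ.+ o) → ∀ (g : ℕ → ℤ) n x →
  coeffFrom o (map g (applyUpTo f n)) x ≡ ∑ (applyUpTo f n) (λ k → g k * δ₁ (x - + k))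
coeffFrom-map o f f≡ g zero    x = refl
coeffFrom-map o f f≡ g (suc n) x = cong₂ _+_
  (cong (λ k → g (f 0) * δ₁ (x - + k)) (sym (f≡ 0)))
  (coeffFrom-map (suc o) (f ∘ suc) (λ k → trans (f≡ (suc k)) (sym (ℕₚ.+-suc k o))) g n x)

-- Consecutive suffix sums differ by one entry. The correction belongs to x + 1 = o, where the
-- coefficients jump from 0 to the full sum.
suffixSums-difference : ∀ o as x →
  coeffFrom o (suffixSums as) x - coeffFrom o (suffixSums as) (x + + 1) ≡
  coeffFrom (suc o) as (x + + 1) - sumℤ as * δ₁ (x + + 1 - + o)
suffixSums-difference o []       x = refl
suffixSums-difference o (a ∷ as) x = begin
  (s * δ₁ (x - + o) + C) - (s * d + C′)
    ≡⟨ split (s * δ₁ (x - + o)) C (s * d) C′ ⟩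
  s * δ₁ (x - + o) + (C - C′) - s * d
    ≡⟨ cong₂ (λ y z → s * δ₁ y + z - s * d) (shift x (+ o)) (suffixSums-difference (suc o) as x) ⟩
  s * d′ + (C″ - sumℤ as * d′) - s * d
    ≡⟨ collect a (sumℤ as) d′ C″ (s * d) ⟩
  (a * d′ + C″) - s * d ∎
  where
  s  = a + sumℤ as
  d  = δ₁ (x + + 1 - + o)
  d′ = δ₁ (x + + 1 - + suc o)
  C  = coeffFrom (suc o) (suffixSums as) x
  C′ = coeffFrom (suc o) (suffixSums as) (x + + 1)
  C″ = coeffFrom (suc (suc o)) as (x + + 1)
  split : ∀ x y z t → (x + y) - (z + t) ≡ x + (y - t) - z
  split = solve-∀
  shift : ∀ x o → x - o ≡ x + + 1 - (+ 1 + o)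
  shift = solve-∀
  collect : ∀ a s d c t → (a + s) * d + (c - s * d) - t ≡ (a * d + c) - t
  collect = solve-∀

-- Coefficientwise, (1 - q⁻¹) χ̄ = q⁻¹ χ. As the entries sum to 0, the boundary term of
-- `suffixSums-difference` is exactly the constant coefficient that `divByQMinus1` dropped.
divByQMinus1-difference : ∀ as x → sumℤ as ≡ + 0 →
  coeffFrom 0 (divByQMinus1 as) x - coeffFrom 0 (divByQMinus1 as) (x + + 1) ≡ coeffFrom 0 as (x + + 1)
divByQMinus1-difference []       x _     = refl
divByQMinus1-difference (a ∷ as) x sum≡0 = trans (suffixSums-difference 0 as x)
  (absorb (coeffFrom 1 as (x + + 1)) a (sumℤ as) (δ₁ (x + + 1 - + 0)) sum≡0)
  where
  absorb : ∀ c a s d → a + s ≡ + 0 → c - s * d ≡ a * d + c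
  absorb c a s d e = trans (sym (ℤₚ.+-identityʳ (c - s * d)))
    (trans (cong (λ z → c - s * d + z * d) (sym e)) (expand c a s d))
    where
    expand : ∀ c a s d → c - s * d + (a + s) * d ≡ a * d + c
    expand = solve-∀

∑-pick : ∀ {t N} → t ℕ.< N → ∀ c (h : ℕ → ℤ) →
  ∑ (upTo N) (λ k → (if ⌊ t ℕₚ.≟ k ⌋ then c else + 0) * h k) ≡ c * h t
∑-pick {t} {N} t<N c h = trans
  (∑-ext (upTo N) (λ k → cong (λ b → (if b then c else + 0) * h k) (isYes≗does (t ℕₚ.≟ k))))
  (pick t<N h)
  where
  pick : ∀ {t N} → t ℕ.< N → ∀ (h : ℕ → ℤ) →
    ∑ (upTo N) (λ k → (if does (t ℕₚ.≟ k) then c else + 0) * h k) ≡ c * h t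
  pick {zero}  {suc N} _           h = trans (∑-upTo-suc N (λ k → (if does (0 ℕₚ.≟ k) then c else + 0) * h k))
    (trans (cong (_+_ (c * h 0)) (∑-zero (upTo N))) (ℤₚ.+-identityʳ (c * h 0)))
  pick {suc t} {suc N} (ℕ.s≤s t<N) h = trans
    (∑-upTo-suc N (λ k → (if does (suc t ℕₚ.≟ k) then c else + 0) * h k))
    (trans (ℤₚ.+-identityˡ _) (pick t<N (h ∘ suc)))

module _ (β : BasisPred m) where

  corank : Subset m → ℕ
  corank S = rkOf β ℕ.∸ rankOf β S

  charCoeff : ℕ → ℤ
  charCoeff k = ∑ (allSubsets m) (λ S → if ⌊ corank S ℕₚ.≟ k ⌋ then sgn S else + 0)

  ∑-charCoeff : ∀ (h : ℕ → ℤ) → ∑ (upTo (suc (rkOf β))) (λ k → charCoeff k * h k) ≡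
                ∑ (allSubsets m) (λ S → sgn S * h (corank S))
  ∑-charCoeff h = begin
    ∑ ks (λ k → charCoeff k * h k)
      ≡⟨ ∑-ext ks (λ k → trans (ℤₚ.*-comm (charCoeff k) (h k)) (sym (∑-*ˡ (allSubsets m) (h k) _))) ⟩
    ∑ ks (λ k → ∑ (allSubsets m) (λ S → h k * (if ⌊ corank S ℕₚ.≟ k ⌋ then sgn S else + 0)))
      ≡⟨ ∑-swap ks (allSubsets m) _ ⟩
    ∑ (allSubsets m) (λ S → ∑ ks (λ k → h k * (if ⌊ corank S ℕₚ.≟ k ⌋ then sgn S else + 0)))
      ≡⟨ ∑-ext (allSubsets m) (λ S → trans (∑-ext ks (λ k → ℤₚ.*-comm (h k) _))
           (∑-pick (ℕ.s≤s (ℕₚ.m∸n≤m (rkOf β) (rankOf β S))) (sgn S) h)) ⟩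
    ∑ (allSubsets m) (λ S → sgn S * h (corank S)) ∎
    where
    ks = upTo (suc (rkOf β))

  coeffFrom-charPoly : ∀ x → coeffFrom 0 (charPoly β) x ≡
                       ∑ (allSubsets m) (λ S → sgn S * δ₁ (x - + corank S))
  coeffFrom-charPoly x = trans
    (coeffFrom-map 0 id (λ k → sym (ℕₚ.+-identityʳ k)) charCoeff (suc (rkOf β)) x)
    (∑-charCoeff (λ k → δ₁ (x - + k)))

-- The value at q = 1 is Σ (-1)^{#S} over all subsets, which vanishes on a non-empty ground set.
-- Hence the division by q - 1 is exact.
sumℤ-charPoly : ∀ {k} (β : BasisPred (suc k)) → sumℤ (charPoly β) ≡ + 0
sumℤ-charPoly {k} β = begin
  ∑ (upTo (suc (rkOf β))) (charCoeff β)
    ≡⟨ ∑-ext (upTo (suc (rkOf β))) (λ i → sym (ℤₚ.*-identityʳ (charCoeff β i))) ⟩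
  ∑ (upTo (suc (rkOf β))) (λ i → charCoeff β i * + 1)
    ≡⟨ ∑-charCoeff β (λ _ → + 1) ⟩
  ∑ (allSubsets (suc k)) (λ S → sgn S * + 1)
    ≡⟨ ∑-ext (allSubsets (suc k)) (λ S → ℤₚ.*-identityʳ (sgn S)) ⟩
  ∑ (allSubsets (suc k)) sgn
    ≡⟨ cong (λ Ss → ∑ Ss sgn) (allSubsets≡below (suc k)) ⟩
  ∑ (below (⊤ {suc k})) sgn
    ≡⟨ ∑-sgn-⊤ k ⟩
  + 0 ∎

-- Sums over weights with a zero entry and over their complement

hasZero : Vec ℕ m → Bool
hasZero w = does (Anyₚ.any? (λ a → a ℕₚ.≟ 0) (Vec.toList w))

∑-reps : ∀ m n (f : Vec ℕ m → ℤ) → ∑ (reps m n) f ≡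
  ∑ (allVecs m n) (λ w → if hasZero w then f w * δ₁ (+ n - + sumℕ w) else + 0)
∑-reps m n f = trans (∑-filter _ (filter _ (allVecs m n)) f) (trans
  (∑-filter (λ w → Anyₚ.any? (λ a → a ℕₚ.≟ 0) (Vec.toList w)) (allVecs m n) _)
  (∑-ext (allVecs m n) (λ w → cong (λ x → if hasZero w then x else + 0) (indicator w))))
  where
  indicator : ∀ w → (if does (⌊ sumℕ w ℕₚ.≟ n ⌋ Boolₚ.≟ true) then f w else + 0) ≡
                    f w * δ₁ (+ n - + sumℕ w)
  indicator w with sumℕ w ℕₚ.≟ n
  ... | yes refl = sym (trans (cong (λ x → f w * δ₁ x) (ℤₚ.+-inverseʳ (+ sumℕ w))) (ℤₚ.*-identityʳ (f w)))
  ... | no  s≢n  = sym (trans (cong (_*_ (f w)) (δ₁-off λ e → s≢n (sym (ℤₚ.+-injective (ℤₚ.i-j≡0⇒i≡j (+ n) (+ sumℕ w) e)))))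
                              (ℤₚ.*-zeroʳ (f w)))

-- The weights without a zero entry are exactly the 1_E + w.
∑-positive : ∀ m N (f : Vec ℕ m → ℤ) →
  ∑ (box (suc N) ⊤) (λ w → if hasZero w then + 0 else f w) ≡ ∑ (box N ⊤) (f ∘ bump ⊤)
∑-positive zero    N f = refl
∑-positive (suc m) N f = begin
  ∑ (box (suc N) ⊤) (λ w → if hasZero w then + 0 else f w)
    ≡⟨ ∑-box-inside (suc N) (⊤ {m}) (λ w → if hasZero w then + 0 else f w) ⟩
  ∑ (upTo (suc N)) (λ a → ∑ (box (suc N) ⊤) (λ w → if hasZero (a ∷ w) then + 0 else f (a ∷ w)))
    ≡⟨ ∑-upTo-suc N (λ a → ∑ (box (suc N) ⊤) (λ w → if hasZero (a ∷ w) then + 0 else f (a ∷ w))) ⟩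
  ∑ (box (suc N) (⊤ {m})) (λ w → + 0) +
  ∑ (upTo N) (λ a → ∑ (box (suc N) ⊤) (λ w → if hasZero w then + 0 else f (suc a ∷ w)))
    ≡⟨ cong₂ _+_ (∑-zero (box (suc N) (⊤ {m}))) (∑-ext (upTo N) (λ a → ∑-positive m N (f ∘ (suc a ∷_)))) ⟩
  + 0 + ∑ (upTo N) (λ a → ∑ (box N ⊤) (λ w → f (suc a ∷ bump ⊤ w)))
    ≡⟨ ℤₚ.+-identityˡ _ ⟩
  ∑ (upTo N) (λ a → ∑ (box N ⊤) (λ w → f (suc a ∷ bump ⊤ w)))
    ≡⟨ ∑-box-inside N (⊤ {m}) (f ∘ bump ⊤) ⟨
  ∑ (box N ⊤) (f ∘ bump ⊤) ∎

box-zero : ∀ N (S : Subset m) → ∣ S ∣ ≡ 0 →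
           ∃ λ w → box N S ≡ w ∷ [] × (∀ B → weight w B ≡ 0) × sumℕ w ≡ 0
box-zero N []            _ = [] , refl , (λ { [] → refl }) , refl
box-zero N (outside ∷ S) e with box-zero N S e
... | w , box≡ , weight≡0 , sum≡0 =
  0 ∷ w , cong (map (0 ∷_)) box≡ , (λ { (true ∷ B) → weight≡0 B ; (false ∷ B) → weight≡0 B }) , sum≡0

below-zero : ∀ (S : Subset m) → ∣ S ∣ ≡ 0 → below S ≡ S ∷ []
below-zero []            _ = refl
below-zero (outside ∷ S) e = cong (map (outside ∷_)) (below-zero S e)

-- The functional equation of Y_S and the coefficients of the zeta function

module _ (M : Matroid m) where

  open MatroidRank M
  open MatroidSeries M

  Y-zero : ∀ S → ∣ S ∣ ≡ 0 → Y S ≐ δ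
  Y-zero S ∣S∣≡0 i j = begin
    ∑ (box N S) (λ w → ∑ (below S) (λ R → term w R i j))
      ≡⟨ cong₂ (λ ws Rs → ∑ ws (λ w → ∑ Rs (λ R → term w R i j))) box≡ (below-zero S ∣S∣≡0) ⟩
    term w₀ S i j + + 0 + + 0
      ≡⟨ trans (ℤₚ.+-identityʳ (term w₀ S i j + + 0)) (ℤₚ.+-identityʳ (term w₀ S i j)) ⟩
    sgn S * δ (i + + exponent w₀ S) (j - + sumℕ w₀)
      ≡⟨ cong₂ _*_ (cong sign ∣S∣≡0) (cong₂ δ
           (trans (cong (λ e → i + + e) exponent≡0) (ℤₚ.+-identityʳ i))
           (trans (cong (λ e → j - + e) sum≡0) (ℤₚ.+-identityʳ j))) ⟩
    + 1 * δ i j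
      ≡⟨ ℤₚ.*-identityˡ (δ i j) ⟩
    δ i j ∎
    where
    N = suc ℤ.∣ j ∣
    w₀ = proj₁ (box-zero N S ∣S∣≡0)
    box≡ = proj₁ (proj₂ (box-zero N S ∣S∣≡0))
    sum≡0 = proj₂ (proj₂ (proj₂ (box-zero N S ∣S∣≡0)))
    rk≡0 : rk w₀ S ≡ 0
    rk≡0 with rk-attained w₀ S
    ... | B , _ , BS = trans (sym BS)
      (ℕₚ.n≤0⇒n≡0 (subst (∣ B ∩ S ∣ ℕ.≤_) ∣S∣≡0 (Subsetₚ.∣p∩q∣≤∣q∣ B S)))
    wt≡0 : wt w₀ ≡ 0
    wt≡0 with maxBasis w₀
    ... | B , (_ , wB) = trans (sym wB) (proj₁ (proj₂ (proj₂ (box-zero N S ∣S∣≡0))) B)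
    exponent≡0 : exponent w₀ S ≡ 0
    exponent≡0 = cong₂ ℕ._+_ rk≡0 wt≡0

  dual-Y-zero : ∀ S → ∣ S ∣ ≡ 0 → dual r Y S ≐ δ
  dual-Y-zero S ∣S∣≡0 i j = begin
    Y S (- i) (- (j + + ∣ S ∣))  ≡⟨ cong (λ s → Y S (- i) (- (j + + s))) ∣S∣≡0 ⟩
    Y S (- i) (- (j + + 0))      ≡⟨ cong (λ x → Y S (- i) (- x)) (ℤₚ.+-identityʳ j) ⟩
    Y S (- i) (- j)              ≡⟨ Y-zero S ∣S∣≡0 (- i) (- j) ⟩
    δ (- i) (- j)                ≡⟨ reflect-δ i j ⟩
    δ i j                        ∎

  -- Y_S(q⁻¹ , T⁻¹) = T^{#S} Y_S(q , T)
  Y-functional-equation : ∀ S → SameRational (Y S) (dual r Y S)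
  Y-functional-equation = recurrence-unique r Y-recurrence (recurrence-dual r Y-recurrence)
    λ S ∣S∣≡0 → SameRational-≐ (≐-sym (≐-trans (Y-zero S ∣S∣≡0) δ≐1▷δ))
                               (≐-sym (≐-trans (dual-Y-zero S ∣S∣≡0) δ≐1▷δ))
                               (SameRational-refl (qPow (+ 0)))
    where
    δ≐1▷δ : δ ≐ qPow (+ 0) ▷ δ
    δ≐1▷δ i j = sym (trans (qPow-▷ (+ 0) δ i j) (cong (λ x → δ x j) (ℤₚ.+-identityʳ i)))

  -- Ensures that the truncated subtraction in `corank` is a true difference.
  rk≤r⊤ : ∀ w S → rk w S ℕ.≤ r ⊤
  rk≤r⊤ w S with rk-attained w S
  ... | B , Bw , BS = subst (ℕ._≤ r ⊤) BS (ℕₚ.≤-trans (Subsetₚ.∣p∩q∣≤∣p∣ B S)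
    (subst (ℕ._≤ r ⊤) (cong ∣_∣ (Subsetₚ.∩-identityʳ B)) (subst (∣ B ∩ ⊤ ∣ ℕ.≤_) (rk-⊤ w) (rk-upper w ⊤ Bw))))

  module _ (n : ℕ) where

    redCoeff : ℤ → Vec ℕ m → ℤ
    redCoeff i w = coeffFrom 0 (redCharPoly (restrictW (isBasis M) w)) (i + ((+ r ⊤ - + 1) + + wt w))

    zetaCoeff-∑ : ∀ i → coeff2 (zetaCoeff (isBasis M) n) i (+ n) ≡ ∑ (reps m n) (redCoeff i)
    zetaCoeff-∑ i = trans (coeff2-▷ (zetaCoeff (isBasis M) n) i (+ n)) (trans
      (∑-concatMap _ (reps m n) _)
      (∑-ext (reps m n) λ w → trans
        (∑-map _ (indexed (redCharPoly (restrictW (isBasis M) w))) _)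
        (trans (∑-ext (indexed (redCharPoly (restrictW (isBasis M) w))) (monomial w))
          (∑-indexed 0 id (λ k → sym (ℕₚ.+-identityʳ k)) (redCharPoly (restrictW (isBasis M) w)) _))))
      where
      monomial : ∀ w p →
        proj₂ p * δ (i - ((+ proj₁ p - (+ r ⊤ - + 1)) - + wt w)) (+ n - + n) ≡
        proj₂ p * δ₁ (i + ((+ r ⊤ - + 1) + + wt w) - + proj₁ p)
      monomial w (k , c) = cong (_*_ c) (trans
        (cong₂ (λ x y → δ₁ x * δ₁ y) (rearrange i (+ k) (+ r ⊤ - + 1) (+ wt w)) (ℤₚ.+-inverseʳ (+ n)))
        (ℤₚ.*-identityʳ _))
        where
        rearrange : ∀ i k s t → i - ((k - s) - t) ≡ i + (s + t) - k
        rearrange = solve-∀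

-- From Y_E to the zeta function

module _ {k : ℕ} (M : Matroid (suc k)) where

  open MatroidRank M
  open MatroidSeries M

  private
    β = isBasis M

  redCoeff-difference : ∀ n i w → redCoeff M n i w - redCoeff M n (i + + 1) w ≡
    ∑ (allSubsets (suc k)) (λ S → sgn S * δ₁ (i + + exponent w S))
  redCoeff-difference n i w = begin
    redCoeff M n i w - redCoeff M n (i + + 1) w
      ≡⟨ cong (λ y → redCoeff M n i w - coeffFrom 0 (redCharPoly β′) y) (shift i (+ r ⊤ - + 1 + + wt w)) ⟩
    coeffFrom 0 (divByQMinus1 (charPoly β′)) x - coeffFrom 0 (divByQMinus1 (charPoly β′)) (x + + 1)
      ≡⟨ divByQMinus1-difference (charPoly β′) x (sumℤ-charPoly β′) ⟩
    coeffFrom 0 (charPoly β′) (x + + 1)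
      ≡⟨ coeffFrom-charPoly β′ (x + + 1) ⟩
    ∑ (allSubsets (suc k)) (λ S → sgn S * δ₁ (x + + 1 - + corank β′ S))
      ≡⟨ ∑-ext (allSubsets (suc k)) (λ S → cong (λ y → sgn S * δ₁ y) (exponent≡ S)) ⟩
    ∑ (allSubsets (suc k)) (λ S → sgn S * δ₁ (i + + exponent w S)) ∎
    where
    β′ = restrictW β w
    x = i + ((+ r ⊤ - + 1) + + wt w)
    shift : ∀ i s → i + + 1 + s ≡ i + s + + 1
    shift = solve-∀
    exponent≡ : ∀ S → x + + 1 - + corank β′ S ≡ i + + exponent w S
    exponent≡ S = begin
      x + + 1 - + corank β′ S
        ≡⟨ cong (λ R → x + + 1 - + (R ℕ.∸ rk w S)) (rk-⊤ w) ⟩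
      x + + 1 - + (r ⊤ ℕ.∸ rk w S)
        ≡⟨ cong (_-_ (x + + 1)) (trans (ℤₚ.m-n≡m⊖n (r ⊤) (rk w S)) (ℤₚ.⊖-≥ (rk≤r⊤ M w S))) ⟨
      x + + 1 - (+ r ⊤ - + rk w S)
        ≡⟨ cancel i (+ r ⊤) (+ wt w) (+ rk w S) ⟩
      i + (+ rk w S + + wt w)
        ≡⟨ cong (_+_ i) (ℤₚ.pos-+ (rk w S) (wt w)) ⟨
      i + + exponent w S ∎
      where
      cancel : ∀ i r t s → i + ((r - + 1) + t) + + 1 - (r - s) ≡ i + (s + t)
      cancel = solve-∀

  term-bump-⊤ : ∀ w R i j →
    term (bump ⊤ w) R i j ≡ term w R (i + + r ⊤) (j - + suc k)
  term-bump-⊤ w R i j = begin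
    term (bump ⊤ w) R i j
      ≡⟨ term-bump {w} {⊤} (λ x x∉⊤ → ⊥-elim (x∉⊤ Subsetₚ.∈⊤)) R i j ⟩
    sgn (R ∪ ⊤) * (sgn E * term w (R ∩ ⊤) (i + + r (R ∪ ⊤)) (j - + ∣ E ∣))
      ≡⟨ cong₂ (λ S R′ → sgn S * (sgn E * term w R′ (i + + r S) (j - + ∣ E ∣)))
           (Subsetₚ.∪-zeroʳ R) (Subsetₚ.∩-identityʳ R) ⟩
    sgn E * (sgn E * term w R (i + + r ⊤) (j - + ∣ E ∣))
      ≡⟨ ℤₚ.*-assoc (sgn E) (sgn E) (term w R (i + + r ⊤) (j - + ∣ E ∣)) ⟨
    sgn E * sgn E * term w R (i + + r ⊤) (j - + ∣ E ∣)
      ≡⟨ cong₂ (λ x n → x * term w R (i + + r ⊤) (j - + n)) (sign² ∣ E ∣) (Subsetₚ.∣⊤∣≡n (suc k)) ⟩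
    + 1 * term w R (i + + r ⊤) (j - + suc k)
      ≡⟨ ℤₚ.*-identityˡ (term w R (i + + r ⊤) (j - + suc k)) ⟩
    term w R (i + + r ⊤) (j - + suc k) ∎
    where
    E : Subset (suc k)
    E = ⊤

  zeta : Series
  zeta = zetaCoeff2 β

  -- (1 - q⁻¹) Z̄_M = (1 - q^{-rk M} T^{#E}) Y_E: Z̄_M sums over the w ∈ ℕ^E with a zero entry, and
  -- w ↦ w + 1 multiplies the summand of Y_E by q^{-rk M} T^{#E}.
  zeta-difference : ∀ i j → zeta i j - zeta (i + + 1) j ≡ Y ⊤ i j - Y ⊤ (i + + r ⊤) (j - + suc k)
  zeta-difference i -[1+ n ] = sym (cong₂ _-_
    (Yᵗ-negative (suc (suc n)) ⊤ i {j = -[1+ n ]} ℤ.-<+)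
    (Yᵗ-negative (suc ℤ.∣ -[1+ n ] - + suc k ∣) ⊤ (i + + r ⊤) {j = -[1+ n ] - + suc k} ℤ.-<+))
  zeta-difference i (+ n)    = begin
    zeta i (+ n) - zeta (i + + 1) (+ n)
      ≡⟨ cong₂ _-_ (zetaCoeff-∑ M n i) (zetaCoeff-∑ M n (i + + 1)) ⟩
    ∑ (reps (suc k) n) (redCoeff M n i) - ∑ (reps (suc k) n) (redCoeff M n (i + + 1))
      ≡⟨ cong (_+_ (∑ (reps (suc k) n) (redCoeff M n i))) (∑-neg (reps (suc k) n) (redCoeff M n (i + + 1))) ⟨
    ∑ (reps (suc k) n) (redCoeff M n i) + ∑ (reps (suc k) n) (λ w → - redCoeff M n (i + + 1) w)
      ≡⟨ ∑-+ (reps (suc k) n) _ _ ⟨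
    ∑ (reps (suc k) n) (λ w → redCoeff M n i w - redCoeff M n (i + + 1) w)
      ≡⟨ ∑-ext (reps (suc k) n) (redCoeff-difference n i) ⟩
    ∑ (reps (suc k) n) (λ w → ∑ (allSubsets (suc k)) (λ S → sgn S * δ₁ (i + + exponent w S)))
      ≡⟨ ∑-reps (suc k) n _ ⟩
    ∑ (allVecs (suc k) n) (λ w → if hasZero w
      then ∑ (allSubsets (suc k)) (λ S → sgn S * δ₁ (i + + exponent w S)) * δ₁ (+ n - + sumℕ w) else + 0)
      ≡⟨ cong₂ ∑ (allVecs≡box (suc k) n) refl ⟩
    ∑ (box (suc n) ⊤) (λ w → if hasZero w
      then ∑ (allSubsets (suc k)) (λ S → sgn S * δ₁ (i + + exponent w S)) * δ₁ (+ n - + sumℕ w) else + 0)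
      ≡⟨ ∑-ext (box (suc n) ⊤) (λ w → trans (cong (λ x → if hasZero w then x else + 0) (collect w)) (complement (hasZero w) (T w))) ⟩
    ∑ (box (suc n) ⊤) (λ w → T w + - (if hasZero w then + 0 else T w))
      ≡⟨ ∑-+ (box (suc n) ⊤) T _ ⟩
    Y ⊤ i (+ n) + ∑ (box (suc n) ⊤) (λ w → - (if hasZero w then + 0 else T w))
      ≡⟨ cong (_+_ (Y ⊤ i (+ n))) (∑-neg (box (suc n) (⊤ {suc k})) (λ w → if hasZero w then + 0 else T w)) ⟩
    Y ⊤ i (+ n) - ∑ (box (suc n) ⊤) (λ w → if hasZero w then + 0 else T w)
      ≡⟨ cong (_-_ (Y ⊤ i (+ n))) (trans (∑-positive (suc k) n T)
           (∑-ext (box n ⊤) (λ w → ∑-ext (below ⊤) (λ R → term-bump-⊤ w R i (+ n))))) ⟩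
    Y ⊤ i (+ n) - Yᵗ n ⊤ (i + + r ⊤) (+ n - + suc k)
      -- Truncation at n is deep enough here: #E ≥ 1 gives n - #E < n.
      ≡⟨ cong (_-_ (Y ⊤ i (+ n))) (Y≡Yᵗ n ⊤ (i + + r ⊤) n-m<n) ⟨
    Y ⊤ i (+ n) - Y ⊤ (i + + r ⊤) (+ n - + suc k) ∎
    where
    T : Vec ℕ (suc k) → ℤ
    T w = ∑ (below ⊤) (λ R → term w R i (+ n))
    complement : ∀ b x → (if b then x else + 0) ≡ x + - (if b then + 0 else x)
    complement true  x = sym (ℤₚ.+-identityʳ x)
    complement false x = sym (ℤₚ.+-inverseʳ x)
    collect : ∀ w → ∑ (allSubsets (suc k)) (λ S → sgn S * δ₁ (i + + exponent w S)) * δ₁ (+ n - + sumℕ w) ≡ T w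
    collect w = begin
      ∑ (allSubsets (suc k)) (λ S → sgn S * δ₁ (i + + exponent w S)) * d
        ≡⟨ ℤₚ.*-comm (∑ (allSubsets (suc k)) (λ S → sgn S * δ₁ (i + + exponent w S))) d ⟩
      d * ∑ (allSubsets (suc k)) (λ S → sgn S * δ₁ (i + + exponent w S))
        ≡⟨ ∑-*ˡ (allSubsets (suc k)) d _ ⟨
      ∑ (allSubsets (suc k)) (λ S → d * (sgn S * δ₁ (i + + exponent w S)))
        ≡⟨ ∑-ext (allSubsets (suc k)) (λ S → trans (ℤₚ.*-comm d _) (ℤₚ.*-assoc (sgn S) _ d)) ⟩
      ∑ (allSubsets (suc k)) (λ S → term w S i (+ n))
        ≡⟨ cong (λ Ss → ∑ Ss (λ S → term w S i (+ n))) (allSubsets≡below (suc k)) ⟩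
      T w ∎
      where
      d = δ₁ (+ n - + sumℕ w)
    n-m<n : + n - + suc k ℤ.< + n
    n-m<n = ℤₚ.m⊖1+n<m n (suc k)

  κ : ℤ
  κ = + r ⊤ - + 1

  private
    1-q⁻¹ 1-x : Poly2
    1-q⁻¹ = binom (- (+ 1)) (+ 0)
    1-x   = binom (- + r ⊤) (+ suc k)

  1-q⁻¹-zeta : 1-q⁻¹ ▷ zeta ≐ 1-x ▷ Y ⊤
  1-q⁻¹-zeta i j = begin
    (1-q⁻¹ ▷ zeta) i j
      ≡⟨ binom-▷ (- (+ 1)) (+ 0) zeta i j ⟩
    zeta i j - zeta (i + + 1) (j - + 0)
      ≡⟨ cong (λ y → zeta i j - zeta (i + + 1) y) (ℤₚ.+-identityʳ j) ⟩
    zeta i j - zeta (i + + 1) j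
      ≡⟨ zeta-difference i j ⟩
    Y ⊤ i j - Y ⊤ (i + + r ⊤) (j - + suc k)
      ≡⟨ cong (λ x → Y ⊤ i j - Y ⊤ (i + x) (j - + suc k)) (ℤₚ.neg-involutive (+ r ⊤)) ⟨
    Y ⊤ i j - Y ⊤ (i - - + r ⊤) (j - + suc k)
      ≡⟨ binom-▷ (- + r ⊤) (+ suc k) (Y ⊤) i j ⟨
    (1-x ▷ Y ⊤) i j ∎

  1-q⁻¹-reflect-zeta : 1-q⁻¹ ▷ reflect zeta ≐ qPow κ ▷ 1-x ▷ dual r Y ⊤
  1-q⁻¹-reflect-zeta i j = begin
    (1-q⁻¹ ▷ reflect zeta) i j
      ≡⟨ binom-▷ (- (+ 1)) (+ 0) (reflect zeta) i j ⟩
    zeta (- i) (- j) - zeta (- (i + + 1)) (- (j - + 0))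
      ≡⟨ cong₂ (λ x y → zeta x (- j) - zeta i′ (- y)) (unshift i) (ℤₚ.+-identityʳ j) ⟩
    zeta (i′ + + 1) (- j) - zeta i′ (- j)
      ≡⟨ flip (zeta (i′ + + 1) (- j)) (zeta i′ (- j)) ⟩
    - (zeta i′ (- j) - zeta (i′ + + 1) (- j))
      ≡⟨ cong -_ (zeta-difference i′ (- j)) ⟩
    - (Y ⊤ i′ (- j) - Y ⊤ (i′ + + r ⊤) (- j - + suc k))
      ≡⟨ flip (Y ⊤ (i′ + + r ⊤) (- j - + suc k)) (Y ⊤ i′ (- j)) ⟨
    Y ⊤ (i′ + + r ⊤) (- j - + suc k) - Y ⊤ i′ (- j)
      ≡⟨ cong₂ _-_
           (cong₂ (Y ⊤) (q-exponent i (+ r ⊤)) (T-exponent j (+ suc k)))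
           (cong₂ (Y ⊤) (q-exponent′ i (+ r ⊤)) (T-exponent′ j (+ suc k))) ⟩
    Y ⊤ (- (i - κ)) (- (j + + suc k)) - Y ⊤ (- (i - κ - - + r ⊤)) (- (j - + suc k + + suc k))
      ≡⟨ cong (λ n → Y ⊤ (- (i - κ)) (- (j + + n)) - Y ⊤ (- (i - κ - - + r ⊤)) (- (j - + suc k + + n)))
           (Subsetₚ.∣⊤∣≡n (suc k)) ⟨
    dual r Y ⊤ (i - κ) j - dual r Y ⊤ (i - κ - - + r ⊤) (j - + suc k)
      ≡⟨ binom-▷ (- + r ⊤) (+ suc k) (dual r Y ⊤) (i - κ) j ⟨
    (1-x ▷ dual r Y ⊤) (i - κ) j
      ≡⟨ qPow-▷ κ (1-x ▷ dual r Y ⊤) i j ⟨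
    (qPow κ ▷ 1-x ▷ dual r Y ⊤) i j ∎
    where
    i′ = - (i + + 1)
    unshift : ∀ i → - i ≡ - (i + + 1) + + 1
    unshift = solve-∀
    flip : ∀ x y → x - y ≡ - (y - x)
    flip = solve-∀
    q-exponent : ∀ i r → - (i + + 1) + r ≡ - (i - (r - + 1))
    q-exponent = solve-∀
    q-exponent′ : ∀ i r → - (i + + 1) ≡ - (i - (r - + 1) - - r)
    q-exponent′ = solve-∀
    T-exponent : ∀ j n → - j - n ≡ - (j + n)
    T-exponent = solve-∀
    T-exponent′ : ∀ j n → - j ≡ - (j - n + n)
    T-exponent′ = solve-∀

  zeta-functional-equation : SameRational (qPow κ ▷ zeta) (reflect zeta)
  zeta-functional-equation = SameRational-÷ 1-q⁻¹ (Regular-binom (- (+ 1)) (+ 0) (inj₁ λ ()))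
    (SameRational-≐
      (λ i j → trans (▷-cong (qPow κ) (≐-sym 1-q⁻¹-zeta) i j) (▷-comm (qPow κ) 1-q⁻¹ zeta i j))
      (≐-sym 1-q⁻¹-reflect-zeta)
      (SameRational-▷ (qPow κ) (SameRational-▷ 1-x (Y-functional-equation M ⊤))))

  open SameRational zeta-functional-equation
    renaming (denominator to D; numerator to N; regular to D-regular; equationˡ to D▷q▷Z; equationʳ to D▷Zι)

  mulZeta-▷ : ∀ Q → mulZeta β Q ≐ Q ▷ zeta
  mulZeta-▷ Q i j = ∑-ext Q (λ _ → refl)

  -- Rationality is a by-product: the fraction shared by q^κ Z̄_M and its mirror image already has
  -- Laurent polynomials above and below.
  zeta-rational : ∃ λ P → ∃ λ Q → Represents β P Q
  zeta-rational = N , D · qPow κ , D-regular (qPow κ) qPow≢0 , λ i j → begin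
    mulZeta β (D · qPow κ) i j   ≡⟨ mulZeta-▷ (D · qPow κ) i j ⟩
    ((D · qPow κ) ▷ zeta) i j    ≡⟨ ▷-· D (qPow κ) zeta i j ⟩
    (D ▷ qPow κ ▷ zeta) i j      ≡⟨ D▷q▷Z i j ⟩
    (N ▷ δ) i j                  ≡⟨ coeff2-▷ N i j ⟨
    coeff2 N i j                 ∎
    where
    qPow≢0 : NonZero2 (qPow κ)
    qPow≢0 = κ , + 0 , λ e → 1≢0 (begin
      + 1                        ≡⟨ cong (λ x → δ x (+ 0)) (ℤₚ.+-inverseʳ κ) ⟨
      δ (κ - κ) (+ 0)            ≡⟨ qPow-▷ κ δ κ (+ 0) ⟨
      (qPow κ ▷ δ) κ (+ 0)       ≡⟨ coeff2-▷ (qPow κ) κ (+ 0) ⟨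
      coeff2 (qPow κ) κ (+ 0)    ≡⟨ e ⟩
      + 0                        ∎)
      where
      1≢0 : + 1 ≢ + 0
      1≢0 ()

  -- If P / Q represents Z̄_M, then inverting both represents `reflect zeta`. The claim multiplied
  -- by `D` follows by letting all factors act on series, and `D` is then cancelled between Laurent
  -- polynomials.
  functional-equation : ∀ P Q → Represents β P Q →
    coeff2 (invert P · Q) ≐ coeff2 ((qPow κ · P) · invert Q)
  functional-equation P Q (_ , QZ≡P) = ▷-cancel D (invert P · Q) ((qPow κ · P) · invert Q) D-regular λ i j → begin
    (D ▷ coeff2 (invert P · Q)) i j
      ≡⟨ ▷-cong D (coeff2-· (invert P) Q) i j ⟩
    (D ▷ invert P ▷ Q ▷ δ) i j
      ≡⟨ ▷-cong D (▷-comm (invert P) Q δ) i j ⟩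
    (D ▷ Q ▷ invert P ▷ δ) i j
      ≡⟨ ▷-cong D (▷-cong Q invertP≐) i j ⟩
    (D ▷ Q ▷ invert Q ▷ reflect zeta) i j
      ≡⟨ ▷-comm D Q (invert Q ▷ reflect zeta) i j ⟩
    (Q ▷ D ▷ invert Q ▷ reflect zeta) i j
      ≡⟨ ▷-cong Q (▷-comm D (invert Q) (reflect zeta)) i j ⟩
    (Q ▷ invert Q ▷ D ▷ reflect zeta) i j
      -- The functional equation enters here: `D` sends both expansions to the same Laurent
      -- polynomial. The other steps only permute factors or replace Q Z̄_M by P.
      ≡⟨ ▷-cong Q (▷-cong (invert Q) (λ i j → trans (D▷Zι i j) (sym (D▷q▷Z i j)))) i j ⟩
    (Q ▷ invert Q ▷ D ▷ qPow κ ▷ zeta) i j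
      ≡⟨ ▷-cong Q (▷-comm (invert Q) D (qPow κ ▷ zeta)) i j ⟩
    (Q ▷ D ▷ invert Q ▷ qPow κ ▷ zeta) i j
      ≡⟨ ▷-comm Q D (invert Q ▷ qPow κ ▷ zeta) i j ⟩
    (D ▷ Q ▷ invert Q ▷ qPow κ ▷ zeta) i j
      ≡⟨ ▷-cong D (▷-comm Q (invert Q) (qPow κ ▷ zeta)) i j ⟩
    (D ▷ invert Q ▷ Q ▷ qPow κ ▷ zeta) i j
      ≡⟨ ▷-cong D (▷-cong (invert Q) (▷-comm Q (qPow κ) zeta)) i j ⟩
    (D ▷ invert Q ▷ qPow κ ▷ Q ▷ zeta) i j
      ≡⟨ ▷-cong D (▷-cong (invert Q) (▷-cong (qPow κ) QZ≐P)) i j ⟩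
    (D ▷ invert Q ▷ qPow κ ▷ P ▷ δ) i j
      ≡⟨ ▷-cong D (▷-cong (invert Q) (▷-· (qPow κ) P δ)) i j ⟨
    (D ▷ invert Q ▷ (qPow κ · P) ▷ δ) i j
      ≡⟨ ▷-cong D (▷-comm (invert Q) (qPow κ · P) δ) i j ⟩
    (D ▷ (qPow κ · P) ▷ invert Q ▷ δ) i j
      ≡⟨ ▷-cong D (coeff2-· (qPow κ · P) (invert Q)) i j ⟨
    (D ▷ coeff2 ((qPow κ · P) · invert Q)) i j ∎
    where
    QZ≐P : Q ▷ zeta ≐ P ▷ δ
    QZ≐P i j = trans (sym (mulZeta-▷ Q i j)) (trans (QZ≡P i j) (coeff2-▷ P i j))
    invertP≐ : invert P ▷ δ ≐ invert Q ▷ reflect zeta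
    invertP≐ i j = begin
      (invert P ▷ δ) i j              ≡⟨ ▷-cong (invert P) reflect-δ i j ⟨
      (invert P ▷ reflect δ) i j      ≡⟨ ▷-reflect P δ i j ⟩
      (P ▷ δ) (- i) (- j)             ≡⟨ QZ≐P (- i) (- j) ⟨
      (Q ▷ zeta) (- i) (- j)          ≡⟨ ▷-reflect Q zeta i j ⟨
      (invert Q ▷ reflect zeta) i j   ∎

theorem1p2 : ∀ {k : ℕ} (M : Matroid (suc k)) →
    (∃ λ P → ∃ λ Q → Represents (isBasis M) P Q)
    × (∀ P Q → Represents (isBasis M) P Q →
       ∀ i j → coeff2 (invert P · Q) i j
             ≡ coeff2 ((qPow ((+ rkOf (isBasis M)) - + 1) · P) · invert Q) i j)
theorem1p2 M = zeta-rational M , functional-equation M
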